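{- Let $G=G_{n,1/2}$ and let $Y_n$ be the number of unordered partitions of $V(G)$ into two sets $\{A,B\}$ such that one of $G[A],G[B]$ has all degrees even and the other has all degrees odd. If $n$ is odd, then for $0\le k\le n-1$, $$\Pr(Y_n=2^k)=2^{ -\binom n2}\prod_{i=1}^{\lfloor (n-1-k)/2\rfloor}(1-2^{ -2i})^{ -1}\prod_{i=k+1}^{n-1}(2^i-1),$$ and $\Pr(Y_n=x)=0$ if $x\neq 2^k$ for every such $k$. If $n$ is even, then $\Pr(Y_n=x)=\Pr(Y_{n-1}=x)$ for all $x$.
   Context: $G_{n,1/2}$ is the binomial random graph on vertex set $[n]$ with each edge present independently with probability $1/2$. Empty products equal $1$. -}

module Defs where

open import Data.Bool using (Bool; true; false; _∧_; _∨_; not; if_then_else_)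
open import Data.Unit using (⊤; tt)
open import Data.Product using (_×_; _,_)
open import Data.Nat as ℕ using (ℕ; zero; suc; _∸_; _≡ᵇ_)
open import Data.Nat.Combinatorics using (_C_)
open import Data.Fin using (Fin; zero; suc)
open import Data.Vec using (Vec; []; _∷_; lookup)
open import Data.List using (List; []; _∷_; map; concatMap; length; filterᵇ; allFin; foldr)
open import Data.Integer using (+_)
open import Data.Rational using (ℚ; 0ℚ; 1ℚ; _*_; _-_; 1/_; ≢-nonZero)
open import Data.Rational.Properties using (_≟_)
open import Relation.Nullary using (yes; no)

-- Labelled simple graphs on vertex set Fin n (= [n]).
-- A graph on (suc n) vertices is a graph on the vertices `suc i`
-- together with the neighbourhood (a Vec Bool n) of the vertex `zero`.
-- This is a bijective encoding of all 2^(n C 2) labelled graphs.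

Graph : ℕ → Set
Graph zero    = ⊤
Graph (suc n) = Graph n × Vec Bool n

adj : ∀ {n} → Graph n → Fin n → Fin n → Bool
adj {suc n} (g , v) zero    zero    = false
adj {suc n} (g , v) zero    (suc j) = lookup v j
adj {suc n} (g , v) (suc i) zero    = lookup v i
adj {suc n} (g , v) (suc i) (suc j) = adj g i j

allVecs : (n : ℕ) → List (Vec Bool n)
allVecs zero    = [] ∷ []
allVecs (suc n) = concatMap (λ v → (false ∷ v) ∷ (true ∷ v) ∷ []) (allVecs n)

allGraphs : (n : ℕ) → List (Graph n)
allGraphs zero    = tt ∷ []
allGraphs (suc n) =
  concatMap (λ g → map (λ v → (g , v)) (allVecs n)) (allGraphs n)

allB : ∀ {A : Set} → (A → Bool) → List A → Bool
allB p = foldr (λ x b → p x ∧ b) true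

count : ∀ {A : Set} → (A → Bool) → List A → ℕ
count p xs = length (filterᵇ p xs)

isEven : ℕ → Bool
isEven zero          = true
isEven (suc zero)    = false
isEven (suc (suc k)) = isEven k

Subset : ℕ → Set
Subset n = Vec Bool n

compl : ∀ {n} → Subset n → Subset n
compl = Data.Vec.map not

degIn : ∀ {n} → Graph n → Subset n → Fin n → ℕ
degIn {n} g A v = count (λ u → lookup A u ∧ adj g v u) (allFin n)

allEvenIn : ∀ {n} → Graph n → Subset n → Bool
allEvenIn {n} g A = allB (λ v → not (lookup A v) ∨ isEven (degIn g A v)) (allFin n)

allOddIn : ∀ {n} → Graph n → Subset n → Bool
allOddIn {n} g A = allB (λ v → not (lookup A v) ∨ not (isEven (degIn g A v))) (allFin n)

goodSplit : ∀ {n} → Graph n → Subset n → Bool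
goodSplit g A = (allEvenIn g A ∧ allOddIn g (compl A))
              ∨ (allOddIn g A ∧ allEvenIn g (compl A))

-- Y_n(G): number of unordered partitions {A,B} of V(G) (parts may be empty).
-- Each unordered partition {A, Aᶜ} corresponds to exactly two subsets
-- A, Aᶜ (distinct when n ≥ 1), and goodSplit is symmetric, hence the halving.
Y : ∀ {n} → Graph n → ℕ
Y {n} g = count (goodSplit g) (allVecs n) ℕ./ 2

fromℕ : ℕ → ℚ
fromℕ k = (+ k) Data.Rational./ 1

_^ℚ_ : ℚ → ℕ → ℚ
p ^ℚ zero  = 1ℚ
p ^ℚ suc k = p * (p ^ℚ k)

half : ℚ
half = (+ 1) Data.Rational./ 2

-- multiplicative inverse (only ever applied to nonzero arguments here;
-- returns 0 on 0 as a totality convention)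
inv : ℚ → ℚ
inv p with p ≟ 0ℚ
... | yes _  = 0ℚ
... | no p≢0 = 1/_ p {{≢-nonZero p≢0}}

-- ∏_{i=a}^{b} f i  (empty product = 1 when b < a)
prodFromTo : ℕ → ℕ → (ℕ → ℚ) → ℚ
prodFromTo a b f = go (suc b ∸ a) a
  where
  go : ℕ → ℕ → ℚ
  go zero    i = 1ℚ
  go (suc m) i = f i * go m (suc i)

-- Pr(Y_n = x) for G = G_{n,1/2}: uniform over the 2^(n C 2) labelled graphs
PrY : (n x : ℕ) → ℚ
PrY n x = fromℕ (count (λ g → Y g ≡ᵇ x) (allGraphs n)) * (half ^ℚ (n C 2))

formula : (n k : ℕ) → ℚ
formula n k =
  (half ^ℚ (n C 2))
  * prodFromTo 1 ((n ∸ 1 ∸ k) ℕ./ 2) (λ i → inv (1ℚ - (half ^ℚ (2 ℕ.* i))))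
  * prodFromTo (k ℕ.+ 1) (n ∸ 1) (λ i → fromℕ (2 ℕ.^ i) - 1ℚ)

{-# OPTIONS --safe #-}
module Submission where

open import Defs
open import Data.Bool as Bool using (Bool; true; false; _∧_; _∨_; _xor_; not)
open import Data.Bool.Properties using (∧-conicalˡ; ∧-conicalʳ; ∧-comm; not-involutive)
open import Data.Empty using (⊥; ⊥-elim)
open import Data.Fin using (Fin; zero; suc)
import Data.Integer as ℤ
import Data.Integer.Properties as ℤ
open import Data.List using (List; []; _∷_; _++_; map; concatMap; length; tabulate)
open import Data.Nat using (ℕ; zero; suc; _+_; _*_; _^_; _/_; _∸_; _<_; _≤_; z≤n; s≤s; _≡ᵇ_; ⌊_/2⌋)
open import Data.Nat.Combinatorics using (_C_; nC1≡n; nCk+nC[k+1]≡[n+1]C[k+1])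
open import Data.Nat.Coprimality using (Coprime; 1-coprimeTo) renaming (sym to coprime-sym)
open import Data.Nat.DivMod using (m*n/n≡m; +-distrib-/-∣ˡ)
open import Data.Nat.Divisibility using (_∣?_; divides; ∣-refl)
open import Data.Nat.Properties
  using (+-assoc; +-comm; +-identityʳ; +-suc; *-zeroʳ; *-comm; *-cancelˡ-≡; ≡ᵇ⇒≡; _≟_; suc-injective; ≤-<-trans;
         m≤n⇒m≤1+n; <⇒≢; ^-distribˡ-+-*; ^-monoʳ-<; m*n≡1⇒m≡1; m+n∸m≡n; m+[n∸m]≡n; n<1+n)
import Data.Nat.Solver as ℕ-Solver
open import Data.Product using (_×_; _,_)
open import Data.Rational as ℚ using (ℚ; 0ℚ; 1ℚ; mkℚ; ≢-nonZero)
import Data.Rational.Properties as ℚ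
import Data.Rational.Solver as ℚ-Solver
open import Data.Sum using (_⊎_; inj₁; inj₂)
open import Data.Unit using (tt)
open import Data.Vec using (Vec; []; _∷_; lookup; insertAt; zipWith; replicate)
import Data.Vec as Vec
open import Data.Vec.Properties using (lookup-zipWith; lookup-map)
open import Function using (_∘_; id)
open import Relation.Binary.PropositionalEquality
open import Relation.Nullary using (yes; no)

-- For a vertex set A with indicator vector x, "G[A] even and G[V∖A] odd" is a linear system S x = diag S
-- over 𝔽₂, where S = (Laplacian of G) + I is symmetric with S 1 = 1; so Y counts the solutions.
-- Call sols W the number of solutions of W z = diag W. The system says xᵀWz = xᵀWx for all x, hence
-- sols is invariant under change of basis. Taking 1 as the first basis vector turns S into the matrix with
-- first row (n mod 2, 1, …, 1) and the remaining block T, a uniformly random symmetric matrix.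
-- Pivoting on the first row (diagonal pivot for n odd, hyperbolic 2 × 2 pivot for n even) leaves a
-- uniformly random symmetric matrix of size n − 1, respectively n − 2.
-- The same pivots give a three-term recursion for the distribution of sols on random symmetric matrices,
-- which the explicit product satisfies.

-- The right side `diag W` is what makes the system basis-free: over 𝔽₂ the cross terms of xᵀWx
-- cancel in pairs, so x · diag W = xᵀWx. It also makes the system consistent, since xᵀWx = 0
-- whenever W x = 0. Hence `sols W` is 2 to the corank of W, and the product to be reached is the
-- count of symmetric 𝔽₂ matrices of given corank. The code works with `sols` alone: a pivot
-- preserves it and a zero row doubles it.
--
-- Uniform randomness is expressed by sums over all matrices. A pivot replaces the remaining block
-- by itself plus a matrix built only from the eliminated rows, and such a translation permutes the
-- summands.
--
-- The sums carry an arbitrary test function `p` because the doubling for a zero row then becomes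
-- precomposition, `p ∘ (2 *_)`. The count 2 ^ suc m - 1 of nonzero rows would bring a subtraction
-- into ℕ; its negative part is kept on the other side of the equations until they are moved to ℚ.

private variable
  A B : Set
  m n : ℕ

-- Boolean identities by truth table

Op : ℕ → Set
Op zero    = Bool × Bool
Op (suc n) = Bool → Op n

infix 4 _==_
_==_ : Bool → Bool → Bool
a == b = not (a xor b)

==-sound : ∀ a b → (a == b) ≡ true → a ≡ b
==-sound false false _ = refl
==-sound true  true  _ = refl

Identity : ∀ n → Op n → Set
Identity zero    (a , b) = a ≡ b
Identity (suc n) f       = ∀ x → Identity n (f x)

table : ∀ n → Op n → Bool
table zero    (a , b) = a == b
table (suc n) f       = table n (f false) ∧ table n (f true)

-- For a concrete `f` the table evaluates to `true`, so the premise is `refl`; opaque subterms of a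
-- goal are passed as the variables.
by-table : ∀ n (f : Op n) → table n f ≡ true → Identity n f
by-table zero    (a , b) p       = ==-sound a b p
by-table (suc n) f       p false = by-table n (f false) (∧-conicalˡ _ _ p)
by-table (suc n) f       p true  = by-table n (f true) (∧-conicalʳ (table n (f false)) _ p)

-- Finite sums

∑ : List A → (A → ℕ) → ℕ
∑ []       f = 0
∑ (x ∷ xs) f = f x + ∑ xs f

∑-cong : ∀ (xs : List A) {f g : A → ℕ} → (∀ x → f x ≡ g x) → ∑ xs f ≡ ∑ xs g
∑-cong []       e = refl
∑-cong (x ∷ xs) e = cong₂ _+_ (e x) (∑-cong xs e)

∑-zero : ∀ (xs : List A) → ∑ xs (λ _ → 0) ≡ 0
∑-zero []       = refl
∑-zero (x ∷ xs) = ∑-zero xs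

∑-const : ∀ (xs : List A) c → ∑ xs (λ _ → c) ≡ length xs * c
∑-const []       c = refl
∑-const (x ∷ xs) c = cong (c +_) (∑-const xs c)

∑-+ : ∀ (xs : List A) (f g : A → ℕ) → ∑ xs (λ x → f x + g x) ≡ ∑ xs f + ∑ xs g
∑-+ []       f g = refl
∑-+ (x ∷ xs) f g rewrite ∑-+ xs f g =
  solve 4 (λ a b c d → (a :+ b) :+ (c :+ d) := (a :+ c) :+ (b :+ d)) refl
    (f x) (g x) (∑ xs f) (∑ xs g)
  where open ℕ-Solver.+-*-Solver

∑-comm : ∀ (xs : List A) (ys : List B) (f : A → B → ℕ) →
         ∑ xs (λ x → ∑ ys (f x)) ≡ ∑ ys (λ y → ∑ xs (λ x → f x y))
∑-comm []       ys f = sym (∑-zero ys)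
∑-comm (x ∷ xs) ys f = trans (cong (∑ ys (f x) +_) (∑-comm xs ys f))
                             (sym (∑-+ ys (f x) (λ y → ∑ xs (λ x → f x y))))

∑-++ : ∀ (xs ys : List A) (f : A → ℕ) → ∑ (xs ++ ys) f ≡ ∑ xs f + ∑ ys f
∑-++ []       ys f = refl
∑-++ (x ∷ xs) ys f = trans (cong (f x +_) (∑-++ xs ys f)) (sym (+-assoc (f x) _ _))

∑-map : ∀ (h : A → B) (xs : List A) (f : B → ℕ) → ∑ (map h xs) f ≡ ∑ xs (f ∘ h)
∑-map h []       f = refl
∑-map h (x ∷ xs) f = cong (f (h x) +_) (∑-map h xs f)

∑-concatMap : ∀ (h : A → List B) (xs : List A) (f : B → ℕ) →
              ∑ (concatMap h xs) f ≡ ∑ xs (λ x → ∑ (h x) f)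
∑-concatMap h []       f = refl
∑-concatMap h (x ∷ xs) f = trans (∑-++ (h x) (concatMap h xs) f)
                                 (cong (∑ (h x) f +_) (∑-concatMap h xs f))

ind : Bool → ℕ
ind false = 0
ind true  = 1

count≡∑ : ∀ (p : A → Bool) xs → count p xs ≡ ∑ xs (ind ∘ p)
count≡∑ p []       = refl
count≡∑ p (x ∷ xs) with p x
... | false = count≡∑ p xs
... | true  = cong suc (count≡∑ p xs)

-- Opaque, so that sums over it stay folded and their summands can be inferred by unification.
opaque
  bools : List Bool
  bools = false ∷ true ∷ []

  ∑-bools : ∀ (f : Bool → ℕ) → ∑ bools f ≡ f false + f true
  ∑-bools f = cong (f false +_) (+-identityʳ (f true))

  ∑-allVecs-suc : ∀ n (f : Vec Bool (suc n) → ℕ) →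
                  ∑ (allVecs (suc n)) f ≡ ∑ bools (λ b → ∑ (allVecs n) (λ v → f (b ∷ v)))
  ∑-allVecs-suc n f = trans (∑-concatMap _ (allVecs n) f) (∑-comm (allVecs n) bools (λ v b → f (b ∷ v)))

∑-allGraphs-suc : ∀ n (f : Graph (suc n) → ℕ) →
                  ∑ (allGraphs (suc n)) f ≡ ∑ (allGraphs n) (λ g → ∑ (allVecs n) (λ v → f (g , v)))
∑-allGraphs-suc n f = trans (∑-concatMap _ (allGraphs n) f)
                            (∑-cong (allGraphs n) λ g → ∑-map (g ,_) (allVecs n) f)

length≡∑ : ∀ (xs : List A) → length xs ≡ ∑ xs (λ _ → 1)
length≡∑ []       = refl
length≡∑ (x ∷ xs) = cong suc (length≡∑ xs)

length-allVecs : ∀ n → length (allVecs n) ≡ 2 ^ n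
length-allVecs zero    = refl
length-allVecs (suc n) = begin
  length (allVecs (suc n))                      ≡⟨ length≡∑ (allVecs (suc n)) ⟩
  ∑ (allVecs (suc n)) (λ _ → 1)                 ≡⟨ ∑-allVecs-suc n _ ⟩
  ∑ bools (λ b → ∑ (allVecs n) (λ _ → 1))       ≡⟨ ∑-bools (λ _ → ∑ (allVecs n) (λ _ → 1)) ⟩
  ∑ (allVecs n) (λ _ → 1) + ∑ (allVecs n) (λ _ → 1)
    ≡⟨ cong (λ l → l + l) (trans (sym (length≡∑ (allVecs n))) (length-allVecs n)) ⟩
  2 ^ n + 2 ^ n                                 ≡⟨ cong (2 ^ n +_) (+-identityʳ (2 ^ n)) ⟨
  2 ^ suc n                                     ∎
  where open ≡-Reasoning

∑-allVecs-const : ∀ n c → ∑ (allVecs n) (λ _ → c) ≡ 2 ^ n * c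
∑-allVecs-const n c = trans (∑-const (allVecs n) c) (cong (_* c) (length-allVecs n))

-- Vectors over the field with two elements

infixr 6 _⊕_
_⊕_ : Vec Bool n → Vec Bool n → Vec Bool n
_⊕_ = zipWith _xor_

scale : Bool → Vec Bool n → Vec Bool n
scale c = Vec.map (_∧ c)

dot : Vec Bool n → Vec Bool n → Bool
dot []      []      = false
dot (a ∷ v) (b ∷ w) = a ∧ b xor dot v w

zeros ones : Vec Bool n
zeros = replicate _ false
ones  = replicate _ true

eqV : Vec Bool n → Vec Bool n → Bool
eqV []      []      = true
eqV (a ∷ v) (b ∷ w) = (a == b) ∧ eqV v w

eqV-sound : ∀ (v w : Vec Bool n) → eqV v w ≡ true → v ≡ w
eqV-sound []      []      _ = refl
eqV-sound (a ∷ v) (b ∷ w) p =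
  cong₂ _∷_ (==-sound a b (∧-conicalˡ _ _ p)) (eqV-sound v w (∧-conicalʳ (a == b) _ p))

dot-comm : ∀ (v w : Vec Bool n) → dot v w ≡ dot w v
dot-comm []      []      = refl
dot-comm (a ∷ v) (b ∷ w) = cong₂ _xor_ (∧-comm a b) (dot-comm v w)

dot-⊕ʳ : ∀ (u v w : Vec Bool n) → dot u (v ⊕ w) ≡ dot u v xor dot u w
dot-⊕ʳ []      []      []      = refl
dot-⊕ʳ (a ∷ u) (b ∷ v) (c ∷ w) rewrite dot-⊕ʳ u v w =
  by-table 5 (λ a b c x y → (a ∧ (b xor c)) xor x xor y , (a ∧ b xor x) xor (a ∧ c xor y))
    refl a b c (dot u v) (dot u w)

dot-scaleʳ : ∀ c (v w : Vec Bool n) → dot v (scale c w) ≡ dot v w ∧ c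
dot-scaleʳ c []      []      = refl
dot-scaleʳ c (a ∷ v) (b ∷ w) rewrite dot-scaleʳ c v w =
  by-table 4 (λ a b c x → a ∧ (b ∧ c) xor x ∧ c , (a ∧ b xor x) ∧ c) refl a b c (dot v w)

dot-⊕ˡ : ∀ (u v w : Vec Bool n) → dot (u ⊕ v) w ≡ dot u w xor dot v w
dot-⊕ˡ u v w rewrite dot-comm (u ⊕ v) w | dot-comm u w | dot-comm v w = dot-⊕ʳ w u v

dot-scaleˡ : ∀ c (v w : Vec Bool n) → dot (scale c v) w ≡ dot v w ∧ c
dot-scaleˡ c v w rewrite dot-comm (scale c v) w | dot-comm v w = dot-scaleʳ c w v

dot-zerosˡ : ∀ (v : Vec Bool n) → dot zeros v ≡ false
dot-zerosˡ []      = refl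
dot-zerosˡ (a ∷ v) = dot-zerosˡ v

compl≡ones⊕ : ∀ (v : Vec Bool n) → compl v ≡ ones ⊕ v
compl≡ones⊕ []      = refl
compl≡ones⊕ (a ∷ v) = cong (not a ∷_) (compl≡ones⊕ v)

compl-involutive : ∀ (v : Vec Bool n) → compl (compl v) ≡ v
compl-involutive []      = refl
compl-involutive (a ∷ v) = cong₂ _∷_ (not-involutive a) (compl-involutive v)

∑-bools-xor : ∀ a (f : Bool → ℕ) → ∑ bools (λ b → f (a xor b)) ≡ ∑ bools f
∑-bools-xor false f = refl
∑-bools-xor true  f rewrite ∑-bools (f ∘ not) | ∑-bools f = +-comm (f true) (f false)

∑-translate : ∀ (w : Vec Bool n) (f : Vec Bool n → ℕ) →
              ∑ (allVecs n) (λ v → f (w ⊕ v)) ≡ ∑ (allVecs n) f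
∑-translate []              f = refl
∑-translate {suc n} (a ∷ w) f = begin
  ∑ (allVecs (suc n)) (λ v → f ((a ∷ w) ⊕ v))
    ≡⟨ ∑-allVecs-suc n _ ⟩
  ∑ bools (λ b → ∑ (allVecs n) (λ v → f ((a xor b) ∷ (w ⊕ v))))
    ≡⟨ ∑-cong bools (λ b → ∑-translate w (λ v → f ((a xor b) ∷ v))) ⟩
  ∑ bools (λ b → ∑ (allVecs n) (λ v → f ((a xor b) ∷ v)))
    ≡⟨ ∑-bools-xor a (λ b → ∑ (allVecs n) (λ v → f (b ∷ v))) ⟩
  ∑ bools (λ b → ∑ (allVecs n) (λ v → f (b ∷ v)))
    ≡⟨ ∑-allVecs-suc n f ⟨
  ∑ (allVecs (suc n)) f ∎
  where open ≡-Reasoning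

-- Symmetric matrices over the field with two elements

data Sym : ℕ → Set where
  []     : Sym 0
  border : Bool → Vec Bool n → Sym n → Sym (suc n)

allSyms : ∀ n → List (Sym n)
allSyms zero    = [] ∷ []
allSyms (suc n) = concatMap (λ a → concatMap (λ v → map (border a v) (allSyms n)) (allVecs n)) bools

∑-allSyms-suc : ∀ n (f : Sym (suc n) → ℕ) →
  ∑ (allSyms (suc n)) f ≡ ∑ bools (λ a → ∑ (allVecs n) (λ v → ∑ (allSyms n) (λ W → f (border a v W))))
∑-allSyms-suc n f = trans (∑-concatMap (λ a → concatMap (extend a) (allVecs n)) bools f) (∑-cong bools λ a →
  trans (∑-concatMap (extend a) (allVecs n) f) (∑-cong (allVecs n) λ v → ∑-map (border a v) (allSyms n) f))
  where
  extend : Bool → Vec Bool n → List (Sym (suc n))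
  extend a v = map (border a v) (allSyms n)

infixl 6 _⊞_
_⊞_ : Sym n → Sym n → Sym n
[]           ⊞ []            = []
border a v W ⊞ border b w X = border (a xor b) (v ⊕ w) (W ⊞ X)

-- The rank one matrix v vᵀ. Its corner is a · a = a, and for the same reason its diagonal is `v`
-- itself.
sq : Vec Bool n → Sym n
sq []      = []
sq (a ∷ v) = border a (scale a v) (sq v)

mul : Sym n → Vec Bool n → Vec Bool n
mul []             []      = []
mul (border a v W) (c ∷ z) = (a ∧ c xor dot v z) ∷ (scale c v ⊕ mul W z)

diag : Sym n → Vec Bool n
diag []             = []
diag (border a v W) = a ∷ diag W

-- Adding a fixed matrix permutes all matrices. This is the form in which "the block left by a pivot
-- is uniformly random" gets used.
∑-⊞ : ∀ (X : Sym n) (f : Sym n → ℕ) → ∑ (allSyms n) (λ W → f (X ⊞ W)) ≡ ∑ (allSyms n) f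
∑-⊞ []                       f = refl
∑-⊞ {suc n} (border a v X) f = begin
  ∑ (allSyms (suc n)) (λ W → f (border a v X ⊞ W))
    ≡⟨ ∑-allSyms-suc n _ ⟩
  ∑ bools (λ b → ∑ (allVecs n) (λ w → ∑ (allSyms n) (λ W → f (border (a xor b) (v ⊕ w) (X ⊞ W)))))
    ≡⟨ ∑-cong bools (λ b → ∑-cong (allVecs n) λ w → ∑-⊞ X (λ W → f (border (a xor b) (v ⊕ w) W))) ⟩
  ∑ bools (λ b → ∑ (allVecs n) (λ w → ∑ (allSyms n) (λ W → f (border (a xor b) (v ⊕ w) W))))
    ≡⟨ ∑-cong bools (λ b → ∑-translate v (λ w → ∑ (allSyms n) (λ W → f (border (a xor b) w W)))) ⟩
  ∑ bools (λ b → ∑ (allVecs n) (λ w → ∑ (allSyms n) (λ W → f (border (a xor b) w W))))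
    ≡⟨ ∑-bools-xor a (λ b → ∑ (allVecs n) (λ w → ∑ (allSyms n) (λ W → f (border b w W)))) ⟩
  ∑ bools (λ b → ∑ (allVecs n) (λ w → ∑ (allSyms n) (λ W → f (border b w W))))
    ≡⟨ ∑-allSyms-suc n f ⟨
  ∑ (allSyms (suc n)) f ∎
  where open ≡-Reasoning

⊕-interchange : ∀ c (v w x y : Vec Bool n) →
                scale c (v ⊕ w) ⊕ (x ⊕ y) ≡ (scale c v ⊕ x) ⊕ (scale c w ⊕ y)
⊕-interchange c []      []      []      []      = refl
⊕-interchange c (v ∷ vs) (w ∷ ws) (x ∷ xs) (y ∷ ys) = cong₂ _∷_
  (by-table 5 (λ c v w x y → ((v xor w) ∧ c) xor x xor y , (v ∧ c xor x) xor (w ∧ c xor y)) refl c v w x y)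
  (⊕-interchange c vs ws xs ys)

mul-⊞ : ∀ (W X : Sym n) z → mul (W ⊞ X) z ≡ mul W z ⊕ mul X z
mul-⊞ []             []             []      = refl
mul-⊞ (border a v W) (border b w X) (c ∷ z) = cong₂ _∷_
  (trans (cong ((a xor b) ∧ c xor_) (dot-⊕ˡ v w z))
    (by-table 5 (λ a b c x y → (a xor b) ∧ c xor x xor y , (a ∧ c xor x) xor (b ∧ c xor y))
      refl a b c (dot v z) (dot w z)))
  (trans (cong (scale c (v ⊕ w) ⊕_) (mul-⊞ W X z)) (⊕-interchange c v w (mul W z) (mul X z)))

scale-xor : ∀ c d (v x y : Vec Bool n) →
            scale (c xor d) v ⊕ (x ⊕ y) ≡ (scale c v ⊕ x) ⊕ (scale d v ⊕ y)
scale-xor c d []      []      []      = refl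
scale-xor c d (v ∷ vs) (x ∷ xs) (y ∷ ys) = cong₂ _∷_
  (by-table 5 (λ c d v x y → (v ∧ (c xor d)) xor x xor y , (v ∧ c xor x) xor (v ∧ d xor y)) refl c d v x y)
  (scale-xor c d vs xs ys)

mul-⊕ : ∀ (W : Sym n) x y → mul W (x ⊕ y) ≡ mul W x ⊕ mul W y
mul-⊕ []             []      []      = refl
mul-⊕ (border a v W) (c ∷ x) (d ∷ y) = cong₂ _∷_
  (trans (cong (a ∧ (c xor d) xor_) (dot-⊕ʳ v x y))
    (by-table 5 (λ a c d x y → a ∧ (c xor d) xor x xor y , (a ∧ c xor x) xor (a ∧ d xor y))
      refl a c d (dot v x) (dot v y)))
  (trans (cong (scale (c xor d) v ⊕_) (mul-⊕ W x y)) (scale-xor c d v (mul W x) (mul W y)))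

scale-⊕-scale : ∀ b c (v x : Vec Bool n) → scale (b ∧ c) v ⊕ scale c x ≡ scale c (scale b v ⊕ x)
scale-⊕-scale b c []       []       = refl
scale-⊕-scale b c (v ∷ vs) (x ∷ xs) = cong₂ _∷_
  (by-table 4 (λ b c v x → (v ∧ (b ∧ c)) xor (x ∧ c) , (v ∧ b xor x) ∧ c) refl b c v x)
  (scale-⊕-scale b c vs xs)

mul-scale : ∀ (W : Sym n) c x → mul W (scale c x) ≡ scale c (mul W x)
mul-scale []             c []      = refl
mul-scale (border a v W) c (b ∷ x) = cong₂ _∷_
  (trans (cong (a ∧ (b ∧ c) xor_) (dot-scaleʳ c v x))
    (by-table 4 (λ a b c x → a ∧ (b ∧ c) xor x ∧ c , (a ∧ b xor x) ∧ c) refl a b c (dot v x)))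
  (trans (cong (scale (b ∧ c) v ⊕_) (mul-scale W c x)) (scale-⊕-scale b c v (mul W x)))

scale-sq : ∀ a c d (v : Vec Bool n) → scale c (scale a v) ⊕ scale d v ≡ scale (a ∧ c xor d) v
scale-sq a c d []       = refl
scale-sq a c d (v ∷ vs) = cong₂ _∷_
  (by-table 4 (λ a c d v → ((v ∧ a) ∧ c) xor (v ∧ d) , v ∧ (a ∧ c xor d)) refl a c d v)
  (scale-sq a c d vs)

mul-sq : ∀ (v z : Vec Bool n) → mul (sq v) z ≡ scale (dot v z) v
mul-sq []      []      = refl
mul-sq (a ∷ v) (c ∷ z) = cong₂ _∷_
  (trans (cong (a ∧ c xor_) (dot-scaleˡ a v z))
    (by-table 3 (λ a c x → a ∧ c xor x ∧ a , a ∧ (a ∧ c xor x)) refl a c (dot v z)))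
  (trans (cong (scale c (scale a v) ⊕_) (mul-sq v z)) (scale-sq a c (dot v z) v))

diag-⊞ : ∀ (W X : Sym n) → diag (W ⊞ X) ≡ diag W ⊕ diag X
diag-⊞ []             []             = refl
diag-⊞ (border a v W) (border b w X) = cong (_ ∷_) (diag-⊞ W X)

diag-sq : ∀ (v : Vec Bool n) → diag (sq v) ≡ v
diag-sq []      = refl
diag-sq (a ∷ v) = cong (a ∷_) (diag-sq v)

mul-sym : ∀ (W : Sym n) x y → dot x (mul W y) ≡ dot (mul W x) y
mul-sym []             []      []      = refl
mul-sym (border a v W) (c ∷ x) (d ∷ y)
  rewrite dot-⊕ʳ x (scale d v) (mul W y) | dot-⊕ˡ (scale c v) (mul W x) y
        | dot-scaleʳ d x v | dot-scaleˡ c v y | mul-sym W x y | dot-comm x v =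
  by-table 6 (λ a c d p q r → (c ∧ (a ∧ d xor p)) xor (q ∧ d) xor r , ((a ∧ c xor q) ∧ d) xor (p ∧ c) xor r)
    refl a c d (dot v y) (dot v x) (dot (mul W x) y)

-- Off-diagonal terms of xᵀWx occur twice and cancel modulo 2; the diagonal ones survive because xᵢ²
-- = xᵢ.
dot-mul-self : ∀ (W : Sym n) x → dot x (mul W x) ≡ dot x (diag W)
dot-mul-self []             []      = refl
dot-mul-self (border a v W) (c ∷ x)
  rewrite dot-⊕ʳ x (scale c v) (mul W x) | dot-scaleʳ c x v | dot-mul-self W x | dot-comm x v =
  by-table 4 (λ a c p r → (c ∧ (a ∧ c xor p)) xor (p ∧ c) xor r , c ∧ a xor r)
    refl a c (dot v x) (dot x (diag W))

-- The system W z = diag W and its elimination steps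

solves : Sym n → Vec Bool n → Bool
solves W z = eqV (mul W z) (diag W)

sols : Sym n → ℕ
sols {n} W = ∑ (allVecs n) (ind ∘ solves W)

sols-border : ∀ a v (W : Sym n) → sols (border a v W) ≡
  ∑ bools (λ c → ∑ (allVecs n) (λ z → ind (((a ∧ c xor dot v z) == a) ∧ eqV (scale c v ⊕ mul W z) (diag W))))
sols-border {n} a v W = ∑-allVecs-suc n (ind ∘ solves (border a v W))

-- With corner 1 the first equation forces c = 1 + v · z. Substituting it leaves the Schur
-- complement W + v vᵀ, and the stray summand `v` moves to the right side, where it is exactly the
-- diagonal of v vᵀ.
sols-pivot : ∀ v (W : Sym n) → sols (border true v W) ≡ sols (sq v ⊞ W)
sols-pivot {n} v W = trans (sols-border true v W) (trans (∑-comm bools (allVecs n) _) (∑-cong (allVecs n) λ z →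
  trans (eliminate (dot v z) (λ c → eqV (scale c v ⊕ mul W z) (diag W)))
        (cong ind (trans (shift (dot v z) v (mul W z) (diag W)) (sym (system z))))))
  where
  eliminate : ∀ t (g : Bool → Bool) → ∑ bools (λ c → ind (((c xor t) == true) ∧ g c)) ≡ ind (g (not t))
  eliminate false g = ∑-bools _
  eliminate true  g = trans (∑-bools _) (+-identityʳ _)

  shift : ∀ {n} t (v x d : Vec Bool n) → eqV (scale (not t) v ⊕ x) d ≡ eqV (scale t v ⊕ x) (v ⊕ d)
  shift t []       []       []       = refl
  shift t (v ∷ vs) (x ∷ xs) (d ∷ ds) = cong₂ _∧_
    (by-table 4 (λ t v x d → ((v ∧ not t xor x) == d) , ((v ∧ t xor x) == (v xor d))) refl t v x d)
    (shift t vs xs ds)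

  system : ∀ z → solves (sq v ⊞ W) z ≡ eqV (scale (dot v z) v ⊕ mul W z) (v ⊕ diag W)
  system z = cong₂ eqV (trans (mul-⊞ (sq v) W z) (cong (_⊕ mul W z) (mul-sq v z)))
                       (trans (diag-⊞ (sq v) W) (cong (_⊕ diag W) (diag-sq v)))

-- A zero row gives the equation 0 = 0 and leaves the first unknown free.
sols-border-zeros : ∀ (W : Sym n) → sols (border false zeros W) ≡ 2 * sols W
sols-border-zeros {n} W = trans (sols-border false zeros W) (trans (∑-cong bools (λ c → ∑-cong (allVecs n) (same c)))
  (trans (∑-bools (λ _ → sols W)) (cong (sols W +_) (sym (+-identityʳ (sols W))))))
  where
  absorb : ∀ {n} c (x : Vec Bool n) → scale c zeros ⊕ x ≡ x
  absorb c []      = refl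
  absorb c (a ∷ x) = cong (a ∷_) (absorb c x)
  same : ∀ c z → ind (((false xor dot zeros z) == false) ∧ eqV (scale c zeros ⊕ mul W z) (diag W))
               ≡ ind (solves W z)
  same c z rewrite dot-zerosˡ z | absorb c (mul W z) = refl

-- This is q vᵀ + v qᵀ + b v vᵀ, the correction in the Schur complement for the block with rows (b,
-- 1) and (1, 0), whose inverse has rows (0, 1) and (1, b). It is written as a sum of three squares
-- so that the lemmas about `sq` apply; scaling by `not b` removes the surplus v vᵀ when b = 1.
hyperbolic : Bool → Vec Bool n → Vec Bool n → Sym n
hyperbolic b q v = sq (q ⊕ v) ⊞ sq q ⊞ sq (scale (not b) v)

sols-hyperbolic : ∀ b q v (R : Sym n) →
               sols (border b (true ∷ q) (border false v R)) ≡ sols (hyperbolic b q v ⊞ R)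
sols-hyperbolic {n} b q v R = begin
  sols (border b (true ∷ q) (border false v R))
    ≡⟨ sols-border b (true ∷ q) (border false v R) ⟩
  ∑ bools (λ c → ∑ (allVecs (suc n)) (λ y → row c y))
    ≡⟨ ∑-cong bools (λ c → ∑-allVecs-suc n (row c)) ⟩
  ∑ bools (λ c → ∑ bools (λ e → ∑ (allVecs n) (λ z → row c (e ∷ z))))
    ≡⟨ ∑-cong bools (λ c → ∑-comm bools (allVecs n) _) ⟩
  ∑ bools (λ c → ∑ (allVecs n) (λ z → ∑ bools (λ e → row c (e ∷ z))))
    ≡⟨ ∑-comm bools (allVecs n) _ ⟩
  ∑ (allVecs n) (λ z → ∑ bools (λ c → ∑ bools (λ e → row c (e ∷ z))))
    ≡⟨ ∑-cong (allVecs n) (λ z → trans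
         (eliminate b (dot q z) (dot v z) (λ c e → eqV (scale c q ⊕ scale e v ⊕ mul R z) (diag R)))
         (cong ind (trans (rearrange b (dot q z) (dot v z) q v (mul R z) (diag R)) (sym (system z))))) ⟩
  sols (hyperbolic b q v ⊞ R) ∎
  where
  open ≡-Reasoning
  row : Bool → Vec Bool (suc n) → ℕ
  row c y = ind (((b ∧ c xor dot (true ∷ q) y) == b)
                 ∧ eqV (scale c (true ∷ q) ⊕ mul (border false v R) y) (false ∷ diag R))

  -- The second equation gives c = u, and then the first gives e = b + b u + t, so exactly one of
  -- the four pairs survives.
  eliminate : ∀ b t u (g : Bool → Bool → Bool) →
    ∑ bools (λ c → ∑ bools (λ e → ind (((b ∧ c xor e xor t) == b) ∧ ((c xor u) == false) ∧ g c e)))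
    ≡ ind (g u (b xor b ∧ u xor t))
  eliminate b t u g = trans (∑-bools _) (trans (cong₂ _+_ (∑-bools _) (∑-bools _)) (cases b t u))
    where
    r : Bool → Bool → Bool → Bool → Bool → ℕ
    r b t u c e = ind (((b ∧ c xor e xor t) == b) ∧ ((c xor u) == false) ∧ g c e)
    cases : ∀ b t u → (r b t u false false + r b t u false true) + (r b t u true false + r b t u true true)
                      ≡ ind (g u (b xor b ∧ u xor t))
    cases false false false = trans (+-identityʳ _) (+-identityʳ _)
    cases false false true  = +-identityʳ _
    cases false true  false = +-identityʳ _
    cases false true  true  = refl
    cases true  false false = +-identityʳ _
    cases true  false true  = +-identityʳ _
    cases true  true  false = trans (+-identityʳ _) (+-identityʳ _)
    cases true  true  true  = refl

  rearrange : ∀ {n} b t u (q v x d : Vec Bool n) →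
    eqV (scale u q ⊕ scale (b xor b ∧ u xor t) v ⊕ x) d
    ≡ eqV (((scale (t xor u) (q ⊕ v) ⊕ scale t q) ⊕ scale (u ∧ not b) (scale (not b) v)) ⊕ x)
          ((((q ⊕ v) ⊕ q) ⊕ scale (not b) v) ⊕ d)
  rearrange b t u []       []       []       []       = refl
  rearrange b t u (q ∷ qs) (v ∷ vs) (x ∷ xs) (d ∷ ds) = cong₂ _∧_
    (by-table 7 (λ b t u q v x d →
        ((q ∧ u xor v ∧ (b xor b ∧ u xor t) xor x) == d) ,
        ((((((q xor v) ∧ (t xor u)) xor q ∧ t) xor (v ∧ not b) ∧ (u ∧ not b)) xor x)
         == ((((q xor v) xor q) xor v ∧ not b) xor d)))
      refl b t u q v x d)
    (rearrange b t u qs vs xs ds)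

  system : ∀ z → solves (hyperbolic b q v ⊞ R) z ≡
    eqV (((scale (dot q z xor dot v z) (q ⊕ v) ⊕ scale (dot q z) q) ⊕ scale (dot v z ∧ not b) (scale (not b) v)) ⊕ mul R z)
        ((((q ⊕ v) ⊕ q) ⊕ scale (not b) v) ⊕ diag R)
  system z = cong₂ eqV
    (begin
      mul (hyperbolic b q v ⊞ R) z
        ≡⟨ mul-⊞ (hyperbolic b q v) R z ⟩
      mul (hyperbolic b q v) z ⊕ mul R z
        ≡⟨ cong (_⊕ mul R z) (trans (mul-⊞ (sq (q ⊕ v) ⊞ sq q) (sq v′) z)
             (cong₂ _⊕_ (trans (mul-⊞ (sq (q ⊕ v)) (sq q) z) (cong₂ _⊕_ (mul-sq (q ⊕ v) z) (mul-sq q z)))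
                        (mul-sq v′ z))) ⟩
      ((scale (dot (q ⊕ v) z) (q ⊕ v) ⊕ scale (dot q z) q) ⊕ scale (dot v′ z) v′) ⊕ mul R z
        ≡⟨ cong₂ (λ s t → ((scale s (q ⊕ v) ⊕ scale (dot q z) q) ⊕ scale t v′) ⊕ mul R z)
             (dot-⊕ˡ q v z) (dot-scaleˡ (not b) v z) ⟩
      ((scale (dot q z xor dot v z) (q ⊕ v) ⊕ scale (dot q z) q) ⊕ scale (dot v z ∧ not b) v′) ⊕ mul R z ∎)
    (trans (diag-⊞ (hyperbolic b q v) R) (cong (_⊕ diag R)
      (trans (diag-⊞ (sq (q ⊕ v) ⊞ sq q) (sq v′))
        (cong₂ _⊕_ (trans (diag-⊞ (sq (q ⊕ v)) (sq q)) (cong₂ _⊕_ (diag-sq (q ⊕ v)) (diag-sq q)))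
                   (diag-sq v′)))))
    where v′ = scale (not b) v

-- Inserting a row and column at an arbitrary position

insertSym : Fin (suc n) → Bool → Vec Bool n → Sym n → Sym (suc n)
insertSym zero    a v       W              = border a v W
insertSym (suc i) a (x ∷ v) (border b w R) = border b (insertAt w i x) (insertSym i a v R)

∑-allVecs-insert : ∀ (i : Fin (suc n)) (f : Vec Bool (suc n) → ℕ) →
  ∑ (allVecs (suc n)) f ≡ ∑ bools (λ b → ∑ (allVecs n) (λ v → f (insertAt v i b)))
∑-allVecs-insert {n}     zero    f = ∑-allVecs-suc n f
∑-allVecs-insert {suc n} (suc i) f = begin
  ∑ (allVecs (2 + n)) f
    ≡⟨ ∑-allVecs-suc (suc n) f ⟩
  ∑ bools (λ a → ∑ (allVecs (suc n)) (λ v → f (a ∷ v)))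
    ≡⟨ ∑-cong bools (λ a → ∑-allVecs-insert i (λ v → f (a ∷ v))) ⟩
  ∑ bools (λ a → ∑ bools (λ b → ∑ (allVecs n) (λ v → f (a ∷ insertAt v i b))))
    ≡⟨ ∑-comm bools bools _ ⟩
  ∑ bools (λ b → ∑ bools (λ a → ∑ (allVecs n) (λ v → f (a ∷ insertAt v i b))))
    ≡⟨ ∑-cong bools (λ b → ∑-allVecs-suc n (λ v → f (insertAt v (suc i) b))) ⟨
  ∑ bools (λ b → ∑ (allVecs (suc n)) (λ v → f (insertAt v (suc i) b))) ∎
  where open ≡-Reasoning

-- Each matrix arises exactly once by an insertion at position `i`. After the induction hypothesis,
-- the chain only moves the sums over the inserted row, `a` and `x ∷ v`, outside those over the
-- remaining matrix `border b w R`.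
∑-allSyms-insert : ∀ (i : Fin (suc n)) (f : Sym (suc n) → ℕ) →
  ∑ (allSyms (suc n)) f ≡ ∑ bools (λ a → ∑ (allVecs n) (λ v → ∑ (allSyms n) (λ W → f (insertSym i a v W))))
∑-allSyms-insert {n}     zero    f = ∑-allSyms-suc n f
∑-allSyms-insert {suc n} (suc i) f = begin
  ∑ (allSyms (2 + n)) f
    ≡⟨ ∑-allSyms-suc (suc n) f ⟩
  ∑ bools (λ b → ∑ (allVecs (suc n)) (λ w → ∑ (allSyms (suc n)) (λ R → f (border b w R))))
    ≡⟨ ∑-cong bools (λ b → trans (∑-allVecs-insert i _)
         (∑-cong bools λ x → ∑-cong (allVecs n) λ w → ∑-allSyms-insert i (λ R → f (border b (insertAt w i x) R)))) ⟩
  ∑ bools (λ b → ∑ bools (λ x → ∑ (allVecs n) (λ w → ∑ bools (λ a → ∑ (allVecs n) (λ v → ∑ (allSyms n) (λ R → t a x v b w R))))))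
    ≡⟨ ∑-cong bools (λ b → ∑-cong bools λ x → ∑-comm (allVecs n) bools _) ⟩
  ∑ bools (λ b → ∑ bools (λ x → ∑ bools (λ a → ∑ (allVecs n) (λ w → ∑ (allVecs n) (λ v → ∑ (allSyms n) (λ R → t a x v b w R))))))
    ≡⟨ ∑-cong bools (λ b → ∑-cong bools λ x → ∑-cong bools λ a → ∑-comm (allVecs n) (allVecs n) _) ⟩
  ∑ bools (λ b → ∑ bools (λ x → ∑ bools (λ a → ∑ (allVecs n) (λ v → ∑ (allVecs n) (λ w → ∑ (allSyms n) (λ R → t a x v b w R))))))
    ≡⟨ ∑-cong bools (λ b → ∑-comm bools bools _) ⟩
  ∑ bools (λ b → ∑ bools (λ a → ∑ bools (λ x → ∑ (allVecs n) (λ v → ∑ (allVecs n) (λ w → ∑ (allSyms n) (λ R → t a x v b w R))))))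
    ≡⟨ ∑-comm bools bools _ ⟩
  ∑ bools (λ a → ∑ bools (λ b → ∑ bools (λ x → ∑ (allVecs n) (λ v → ∑ (allVecs n) (λ w → ∑ (allSyms n) (λ R → t a x v b w R))))))
    ≡⟨ ∑-cong bools (λ a → ∑-comm bools bools _) ⟩
  ∑ bools (λ a → ∑ bools (λ x → ∑ bools (λ b → ∑ (allVecs n) (λ v → ∑ (allVecs n) (λ w → ∑ (allSyms n) (λ R → t a x v b w R))))))
    ≡⟨ ∑-cong bools (λ a → ∑-cong bools λ x → ∑-comm bools (allVecs n) _) ⟩
  ∑ bools (λ a → ∑ bools (λ x → ∑ (allVecs n) (λ v → ∑ bools (λ b → ∑ (allVecs n) (λ w → ∑ (allSyms n) (λ R → t a x v b w R))))))
    ≡⟨ ∑-cong bools (λ a → trans (∑-allVecs-suc n _)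
         (∑-cong bools λ x → ∑-cong (allVecs n) λ v → ∑-allSyms-suc n (λ W → f (insertSym (suc i) a (x ∷ v) W)))) ⟨
  ∑ bools (λ a → ∑ (allVecs (suc n)) (λ v → ∑ (allSyms (suc n)) (λ W → f (insertSym (suc i) a v W)))) ∎
  where
  open ≡-Reasoning
  t : Bool → Bool → Vec Bool n → Bool → Vec Bool n → Sym n → ℕ
  t a x v b w R = f (border b (insertAt w i x) (insertSym i a v R))

dot-insertAt : ∀ (i : Fin (suc n)) a b (v w : Vec Bool n) →
               dot (insertAt v i a) (insertAt w i b) ≡ a ∧ b xor dot v w
dot-insertAt zero    a b v       w       = refl
dot-insertAt (suc i) a b (c ∷ v) (d ∷ w) = trans (cong (c ∧ d xor_) (dot-insertAt i a b v w))
  (by-table 3 (λ x y z → x xor y xor z , y xor x xor z) refl (c ∧ d) (a ∧ b) (dot v w))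

⊕-insertAt : ∀ (i : Fin (suc n)) a b (v w : Vec Bool n) →
             insertAt v i a ⊕ insertAt w i b ≡ insertAt (v ⊕ w) i (a xor b)
⊕-insertAt zero    a b v       w       = refl
⊕-insertAt (suc i) a b (c ∷ v) (d ∷ w) = cong (_ ∷_) (⊕-insertAt i a b v w)

scale-insertAt : ∀ (i : Fin (suc n)) a c (v : Vec Bool n) →
                 scale c (insertAt v i a) ≡ insertAt (scale c v) i (a ∧ c)
scale-insertAt zero    a c v       = refl
scale-insertAt (suc i) a c (b ∷ v) = cong (_ ∷_) (scale-insertAt i a c v)

eqV-insertAt : ∀ (i : Fin (suc n)) a b (v w : Vec Bool n) →
               eqV (insertAt v i a) (insertAt w i b) ≡ (a == b) ∧ eqV v w
eqV-insertAt zero    a b v       w       = refl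
eqV-insertAt (suc i) a b (c ∷ v) (d ∷ w) = trans (cong ((c == d) ∧_) (eqV-insertAt i a b v w))
  (by-table 3 (λ x y z → x ∧ y ∧ z , y ∧ x ∧ z) refl (c == d) (a == b) (eqV v w))

⊕-leftComm : ∀ (x y z : Vec Bool n) → x ⊕ y ⊕ z ≡ y ⊕ x ⊕ z
⊕-leftComm []       []       []       = refl
⊕-leftComm (x ∷ xs) (y ∷ ys) (z ∷ zs) = cong₂ _∷_
  (by-table 3 (λ x y z → x xor y xor z , y xor x xor z) refl x y z) (⊕-leftComm xs ys zs)

mul-insertSym : ∀ (i : Fin (suc n)) a c v (W : Sym n) z →
  mul (insertSym i a v W) (insertAt z i c) ≡ insertAt (scale c v ⊕ mul W z) i (a ∧ c xor dot v z)
mul-insertSym zero    a c v       W              z       = refl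
mul-insertSym (suc i) a c (x ∷ v) (border b w R) (y ∷ z) = cong₂ _∷_
  (trans (cong (b ∧ y xor_) (dot-insertAt i x c w z))
    (by-table 3 (λ p q r → p xor q xor r , q xor p xor r) refl (b ∧ y) (x ∧ c) (dot w z)))
  (begin
    scale y (insertAt w i x) ⊕ mul (insertSym i a v R) (insertAt z i c)
      ≡⟨ cong₂ _⊕_ (scale-insertAt i x y w) (mul-insertSym i a c v R z) ⟩
    insertAt (scale y w) i (x ∧ y) ⊕ insertAt (scale c v ⊕ mul R z) i (a ∧ c xor dot v z)
      ≡⟨ ⊕-insertAt i (x ∧ y) (a ∧ c xor dot v z) (scale y w) (scale c v ⊕ mul R z) ⟩
    insertAt (scale y w ⊕ scale c v ⊕ mul R z) i (x ∧ y xor a ∧ c xor dot v z)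
      ≡⟨ cong₂ (λ u b → insertAt u i b) (⊕-leftComm (scale y w) (scale c v) (mul R z))
           (by-table 3 (λ p q r → p xor q xor r , q xor p xor r) refl (x ∧ y) (a ∧ c) (dot v z)) ⟩
    insertAt (scale c v ⊕ scale y w ⊕ mul R z) i (a ∧ c xor x ∧ y xor dot v z) ∎)
  where open ≡-Reasoning

diag-insertSym : ∀ (i : Fin (suc n)) a v (W : Sym n) → diag (insertSym i a v W) ≡ insertAt (diag W) i a
diag-insertSym zero    a v       W              = refl
diag-insertSym (suc i) a (x ∷ v) (border b w R) = cong (b ∷_) (diag-insertSym i a v R)

-- Moving the inserted index to the front permutes rows, columns and diagonal simultaneously, hence
-- only renames unknowns and equations. It brings a chosen 1 of the first row next to the corner for
-- the 2 × 2 pivot.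
sols-insertSym : ∀ (i : Fin (suc n)) a v (W : Sym n) → sols (insertSym i a v W) ≡ sols (border a v W)
sols-insertSym {n} i a v W = trans (∑-allVecs-insert i _)
  (trans (∑-cong bools λ c → ∑-cong (allVecs n) λ z → cong ind
    (trans (cong₂ eqV (mul-insertSym i a c v W z) (diag-insertSym i a v W))
           (eqV-insertAt i (a ∧ c xor dot v z) a (scale c v ⊕ mul W z) (diag W))))
   (sym (sols-border a v W)))

-- The recursion for the distribution of sols

symSum : ∀ m → (ℕ → ℕ) → ℕ
symSum m p = ∑ (allSyms m) (p ∘ sols)

∑-pivot : ∀ (p : ℕ → ℕ) (v : Vec Bool m) → ∑ (allSyms m) (λ W → p (sols (border true v W))) ≡ symSum m p
∑-pivot {m} p v = trans (∑-cong (allSyms m) λ W → cong p (sols-pivot v W)) (∑-⊞ (sq v) (p ∘ sols))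

-- The 1 at position `i` and the zero corner form a hyperbolic block with the row at `i`. For each
-- choice of that row's remaining bits, `b` and `q`, the rest is a translate of a uniform matrix;
-- there are suc m such bits, hence the factor.
∑-isotropic : ∀ (p : ℕ → ℕ) (i : Fin (suc m)) (v : Vec Bool m) →
  ∑ (allSyms (suc m)) (λ W → p (sols (border false (insertAt v i true) W))) ≡ 2 ^ suc m * symSum m p
∑-isotropic {m} p i v = begin
  ∑ (allSyms (suc m)) (λ W → p (sols (border false (insertAt v i true) W)))
    ≡⟨ ∑-allSyms-insert i _ ⟩
  ∑ bools (λ b → ∑ (allVecs m) (λ q → ∑ (allSyms m) (λ R → p (sols (insertSym (suc i) b (true ∷ q) (border false v R))))))
    ≡⟨ ∑-cong bools (λ b → ∑-cong (allVecs m) λ q → trans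
         (∑-cong (allSyms m) λ R → cong p (trans (sols-insertSym (suc i) b (true ∷ q) (border false v R)) (sols-hyperbolic b q v R)))
         (∑-⊞ (hyperbolic b q v) (p ∘ sols))) ⟩
  ∑ bools (λ b → ∑ (allVecs m) (λ q → symSum m p))
    ≡⟨ ∑-allVecs-suc m (λ _ → symSum m p) ⟨
  ∑ (allVecs (suc m)) (λ _ → symSum m p)
    ≡⟨ ∑-allVecs-const (suc m) (symSum m p) ⟩
  2 ^ suc m * symSum m p ∎
  where open ≡-Reasoning

-- The nonzero vectors are those with a 1 somewhere, and the form `insertAt v i true` hands over the
-- position of the pivot. The extra `c` on the left stands for the -1 in their number.
∑-constant-on-nonzero : ∀ (h : Vec Bool (suc m) → ℕ) c → (∀ i v → h (insertAt v i true) ≡ c) →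
  ∑ (allVecs (suc m)) h + c ≡ h zeros + 2 ^ suc m * c
∑-constant-on-nonzero {zero}  h c e rewrite e zero [] =
  solve 2 (λ x y → x :+ (y :+ con 0) :+ y := x :+ con 2 :* y) refl (h (false ∷ [])) c
  where open ℕ-Solver.+-*-Solver
∑-constant-on-nonzero {suc m} h c e = begin
  ∑ (allVecs (2 + m)) h + c
    ≡⟨ cong (_+ c) (∑-allVecs-suc (suc m) h) ⟩
  ∑ bools (λ b → ∑ (allVecs (suc m)) (λ v → h (b ∷ v))) + c
    ≡⟨ cong (_+ c) (∑-bools _) ⟩
  s + ∑ (allVecs (suc m)) (λ v → h (true ∷ v)) + c
    ≡⟨ cong (λ t → s + t + c) (trans (∑-cong (allVecs (suc m)) (e zero)) (∑-allVecs-const (suc m) c)) ⟩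
  s + 2 ^ suc m * c + c
    ≡⟨ solve 3 (λ s t c → s :+ t :+ c := s :+ c :+ t) refl s (2 ^ suc m * c) c ⟩
  s + c + 2 ^ suc m * c
    ≡⟨ cong (_+ 2 ^ suc m * c) (∑-constant-on-nonzero (λ v → h (false ∷ v)) c (λ i v → e (suc i) (false ∷ v))) ⟩
  h zeros + 2 ^ suc m * c + 2 ^ suc m * c
    ≡⟨ solve 3 (λ x t c → x :+ t :* c :+ t :* c := x :+ (con 2 :* t) :* c) refl (h zeros) (2 ^ suc m) c ⟩
  h zeros + 2 ^ (2 + m) * c ∎
  where
  open ≡-Reasoning
  open ℕ-Solver.+-*-Solver
  s = ∑ (allVecs (suc m)) (λ v → h (false ∷ v))

symSum-suc : ∀ m (p : ℕ → ℕ) → symSum (suc m) p ≡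
  ∑ (allVecs m) (λ v → ∑ (allSyms m) (λ W → p (sols (border false v W)))) + 2 ^ m * symSum m p
symSum-suc m p = trans (∑-allSyms-suc m (p ∘ sols)) (trans (∑-bools _) (cong (isotropic +_)
  (trans (∑-cong (allVecs m) (∑-pivot p)) (∑-allVecs-const m (symSum m p)))))
  where isotropic = ∑ (allVecs m) (λ v → ∑ (allSyms m) (λ W → p (sols (border false v W))))

∑-border-zeros : ∀ m (p : ℕ → ℕ) → ∑ (allSyms m) (λ W → p (sols (border false zeros W))) ≡ symSum m (p ∘ (2 *_))
∑-border-zeros m p = ∑-cong (allSyms m) λ W → cong p (sols-border-zeros W)

symSum-one : ∀ p → symSum 1 p ≡ symSum 0 (p ∘ (2 *_)) + symSum 0 p
symSum-one p = trans (symSum-suc 0 p) (cong₂ _+_ (trans (+-identityʳ _) (∑-border-zeros 0 p)) (+-identityʳ _))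

-- The terms on the right come from a zero first row, a zero corner with a nonzero row, and a corner
-- 1. The summand on the left compensates for counting the zero row among the second kind.
symSum-recursion : ∀ m p → symSum (2 + m) p + 2 ^ suc m * symSum m p
  ≡ symSum (suc m) (p ∘ (2 *_)) + 2 ^ suc m * (2 ^ suc m * symSum m p) + 2 ^ suc m * symSum (suc m) p
symSum-recursion m p = begin
  symSum (2 + m) p + c                                   ≡⟨ cong (_+ c) (symSum-suc (suc m) p) ⟩
  ∑ (allVecs (suc m)) h + d + c                     ≡⟨ solve 3 (λ x d c → x :+ d :+ c := x :+ c :+ d) refl (∑ (allVecs (suc m)) h) d c ⟩
  ∑ (allVecs (suc m)) h + c + d                     ≡⟨ cong (_+ d) (∑-constant-on-nonzero h c (∑-isotropic p)) ⟩
  h zeros + 2 ^ suc m * c + d                       ≡⟨ cong (λ x → x + 2 ^ suc m * c + d) (∑-border-zeros (suc m) p) ⟩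
  symSum (suc m) (p ∘ (2 *_)) + 2 ^ suc m * c + d        ∎
  where
  open ≡-Reasoning
  open ℕ-Solver.+-*-Solver
  h : Vec Bool (suc m) → ℕ
  h v = ∑ (allSyms (suc m)) (λ W → p (sols (border false v W)))
  c = 2 ^ suc m * symSum m p
  d = 2 ^ suc m * symSum (suc m) p

-- The linear system attached to a graph

graphSym : Vec Bool n → Graph n → Sym n
graphSym {zero}  []      tt      = []
graphSym {suc n} (a ∷ d) (g , v) = border a v (graphSym d g)

adjSym : Graph n → Sym n
adjSym = graphSym zeros

mul-graphSym : ∀ (d : Vec Bool n) g z →
               mul (graphSym d g) z ≡ zipWith _∧_ d z ⊕ mul (adjSym g) z
mul-graphSym {zero}  []      tt      []      = refl
mul-graphSym {suc n} (a ∷ d) (g , v) (c ∷ z) = cong (_ ∷_)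
  (trans (cong (scale c v ⊕_) (mul-graphSym d g z)) (⊕-leftComm (scale c v) (zipWith _∧_ d z) (mul (adjSym g) z)))

diag-graphSym : ∀ (d : Vec Bool n) g → diag (graphSym d g) ≡ d
diag-graphSym {zero}  []      tt      = refl
diag-graphSym {suc n} (a ∷ d) (g , v) = cong (a ∷_) (diag-graphSym d g)

-- A graph supplies the entries off the diagonal and `d` the diagonal. In the application the bits
-- of `d` come from the neighbourhood of the vertex `zero`.
∑-graphSym : ∀ n (f : Sym n → ℕ) →
             ∑ (allGraphs n) (λ g → ∑ (allVecs n) (λ d → f (graphSym d g))) ≡ ∑ (allSyms n) f
∑-graphSym zero    f = +-identityʳ _
∑-graphSym (suc n) f = begin
  ∑ (allGraphs (suc n)) (λ g → ∑ (allVecs (suc n)) (λ d → f (graphSym d g)))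
    ≡⟨ ∑-allGraphs-suc n _ ⟩
  ∑ (allGraphs n) (λ g → ∑ (allVecs n) (λ v → ∑ (allVecs (suc n)) (λ d → f (graphSym d (g , v)))))
    ≡⟨ ∑-cong (allGraphs n) (λ g → ∑-cong (allVecs n) λ v → ∑-allVecs-suc n (λ d → f (graphSym d (g , v)))) ⟩
  ∑ (allGraphs n) (λ g → ∑ (allVecs n) (λ v → ∑ bools (λ a → ∑ (allVecs n) (λ d → t a v d g))))
    ≡⟨ ∑-cong (allGraphs n) (λ g → ∑-comm (allVecs n) bools _) ⟩
  ∑ (allGraphs n) (λ g → ∑ bools (λ a → ∑ (allVecs n) (λ v → ∑ (allVecs n) (λ d → t a v d g))))
    ≡⟨ ∑-comm (allGraphs n) bools _ ⟩
  ∑ bools (λ a → ∑ (allGraphs n) (λ g → ∑ (allVecs n) (λ v → ∑ (allVecs n) (λ d → t a v d g))))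
    ≡⟨ ∑-cong bools (λ a → ∑-comm (allGraphs n) (allVecs n) _) ⟩
  ∑ bools (λ a → ∑ (allVecs n) (λ v → ∑ (allGraphs n) (λ g → ∑ (allVecs n) (λ d → t a v d g))))
    ≡⟨ ∑-cong bools (λ a → ∑-cong (allVecs n) λ v → ∑-graphSym n (λ W → f (border a v W))) ⟩
  ∑ bools (λ a → ∑ (allVecs n) (λ v → ∑ (allSyms n) (λ W → f (border a v W))))
    ≡⟨ ∑-allSyms-suc n f ⟨
  ∑ (allSyms (suc n)) f ∎
  where
  open ≡-Reasoning
  t : Bool → Vec Bool n → Vec Bool n → Graph n → ℕ
  t a v d g = f (border a v (graphSym d g))

-- Degrees modulo 2 as matrix-vector products

parity : (Fin n → Bool) → Bool
parity {zero}  p = false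
parity {suc n} p = p zero xor parity (p ∘ suc)

isEven-suc : ∀ k → isEven (suc k) ≡ not (isEven k)
isEven-suc zero          = refl
isEven-suc (suc zero)    = refl
isEven-suc (suc (suc k)) = isEven-suc k

isEven-count : ∀ (p : A → Bool) (f : Fin n → A) → isEven (count p (tabulate f)) ≡ not (parity (p ∘ f))
isEven-count {n = zero}  p f = refl
isEven-count {n = suc n} p f with p (f zero)
... | false = isEven-count p (f ∘ suc)
... | true  = trans (isEven-suc (count p (tabulate (f ∘ suc)))) (cong not (isEven-count p (f ∘ suc)))

parity-dot : ∀ (v w : Vec Bool n) → parity (λ i → lookup v i ∧ lookup w i) ≡ dot w v
parity-dot []      []      = refl
parity-dot (a ∷ v) (b ∷ w) = cong₂ _xor_ (∧-comm a b) (parity-dot v w)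

parity-adj : ∀ (g : Graph n) A i → parity (λ u → lookup A u ∧ adj g i u) ≡ lookup (mul (adjSym g) A) i
parity-adj {suc n} (g , v) (a ∷ A) zero = cong₂ _xor_ (∧-comm a false) (parity-dot A v)
parity-adj {suc n} (g , v) (a ∷ A) (suc i) = trans
  (cong₂ _xor_ (trans (∧-comm a (lookup v i)) (sym (lookup-map i (_∧ a) v))) (parity-adj g A i))
  (sym (lookup-zipWith _xor_ i (scale a v) (mul (adjSym g) A)))

isEven-degIn : ∀ (g : Graph n) A i → isEven (degIn g A i) ≡ not (lookup (mul (adjSym g) A) i)
isEven-degIn g A i = trans (isEven-count (λ u → lookup A u ∧ adj g i u) id) (cong not (parity-adj g A i))

allF : (Fin n → Bool) → Bool
allF {zero}  p = true
allF {suc n} p = p zero ∧ allF (p ∘ suc)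

allB-tabulate : ∀ (p : A → Bool) (f : Fin n → A) → allB p (tabulate f) ≡ allF (p ∘ f)
allB-tabulate {n = zero}  p f = refl
allB-tabulate {n = suc n} p f = cong (p (f zero) ∧_) (allB-tabulate p (f ∘ suc))

allF-cong : ∀ {p q : Fin n → Bool} → (∀ i → p i ≡ q i) → allF p ≡ allF q
allF-cong {zero}  e = refl
allF-cong {suc n} e = cong₂ _∧_ (e zero) (allF-cong (e ∘ suc))

allF-∧ : ∀ (p q : Fin n → Bool) → allF p ∧ allF q ≡ allF (λ i → p i ∧ q i)
allF-∧ {zero}  p q = refl
allF-∧ {suc n} p q = trans
  (by-table 4 (λ a b c d → (a ∧ b) ∧ (c ∧ d) , (a ∧ c) ∧ (b ∧ d)) refl
    (p zero) (allF (p ∘ suc)) (q zero) (allF (q ∘ suc)))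
  (cong ((p zero ∧ q zero) ∧_) (allF-∧ (p ∘ suc) (q ∘ suc)))

eqV-allF : ∀ (v w : Vec Bool n) → eqV v w ≡ allF (λ i → lookup v i == lookup w i)
eqV-allF []      []      = refl
eqV-allF (a ∷ v) (b ∷ w) = cong ((a == b) ∧_) (eqV-allF v w)

-- The Laplacian plus the identity, modulo 2: the diagonal entry at a vertex is its degree plus 1.
splitSym : Graph n → Sym n
splitSym g = graphSym (compl (mul (adjSym g) ones)) g

evenOdd : Graph n → Subset n → Bool
evenOdd g A = allEvenIn g A ∧ allOddIn g (compl A)

-- At a vertex of A the equation says that its degree inside A is even; at a vertex
-- outside A, that its full degree minus its degree into A is odd.
evenOdd≡solves : ∀ (g : Graph n) A → evenOdd g A ≡ solves (splitSym g) A
evenOdd≡solves {n} g A = begin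
  evenOdd g A
    ≡⟨ cong₂ _∧_ (allB-tabulate {n = n} _ id) (allB-tabulate {n = n} _ id) ⟩
  allF (λ i → not (lookup A i) ∨ isEven (degIn g A i))
    ∧ allF (λ i → not (lookup (compl A) i) ∨ not (isEven (degIn g (compl A) i)))
    ≡⟨ allF-∧ {n} _ _ ⟩
  allF (λ i → (not (lookup A i) ∨ isEven (degIn g A i))
              ∧ (not (lookup (compl A) i) ∨ not (isEven (degIn g (compl A) i))))
    ≡⟨ allF-cong pointwise ⟩
  allF (λ i → lookup (zipWith _∧_ d A ⊕ mul (adjSym g) A) i == lookup d i)
    ≡⟨ eqV-allF (zipWith _∧_ d A ⊕ mul (adjSym g) A) d ⟨
  eqV (zipWith _∧_ d A ⊕ mul (adjSym g) A) d
    ≡⟨ cong₂ eqV (mul-graphSym d g A) (diag-graphSym d g) ⟨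
  solves (splitSym g) A ∎
  where
  open ≡-Reasoning
  d = compl (mul (adjSym g) ones)
  pointwise : ∀ i →
    (not (lookup A i) ∨ isEven (degIn g A i)) ∧ (not (lookup (compl A) i) ∨ not (isEven (degIn g (compl A) i)))
    ≡ (lookup (zipWith _∧_ d A ⊕ mul (adjSym g) A) i == lookup d i)
  pointwise i
    rewrite isEven-degIn g A i | isEven-degIn g (compl A) i | compl≡ones⊕ A
          | mul-⊕ (adjSym g) ones A
          | lookup-zipWith _xor_ i (mul (adjSym g) ones) (mul (adjSym g) A)
          | lookup-zipWith _xor_ i (zipWith _∧_ d A) (mul (adjSym g) A)
          | lookup-zipWith _∧_ i d A
          | lookup-map i not (mul (adjSym g) ones)
          | sym (compl≡ones⊕ A)
          | lookup-map i not A =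
    by-table 3 (λ a l e →
        (not a ∨ not l) ∧ (not (not a) ∨ not (not (e xor l))) , ((not e ∧ a xor l) == not e))
      refl (lookup A i) (lookup (mul (adjSym g) A) i) (lookup (mul (adjSym g) ones) i)

ind-∨ : ∀ a b → (a ≡ true → b ≡ true → ⊥) → ind (a ∨ b) ≡ ind a + ind b
ind-∨ false b     _ = refl
ind-∨ true  false _ = refl
ind-∨ true  true  h = ⊥-elim (h refl refl)

-- The vertex `zero` lies on one of the two sides, and its degree there would be both even and odd.
-- On the empty graph both conditions hold vacuously, hence `suc n`.
splits-disjoint : ∀ (g : Graph (suc n)) A → evenOdd g A ≡ true → allOddIn g A ∧ allEvenIn g (compl A) ≡ true → ⊥
splits-disjoint g A p q = absurd (lookup A zero) (isEven (degIn g A zero)) (isEven (degIn g (compl A) zero))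
  (∧-conicalˡ _ _ (∧-conicalˡ (allEvenIn g A) _ p))
  (∧-conicalˡ _ _ (∧-conicalˡ (allOddIn g A) _ q))
  (subst (λ x → not x ∨ not (isEven (degIn g (compl A) zero)) ≡ true) (lookup-map zero not A) (∧-conicalˡ _ _ (∧-conicalʳ (allEvenIn g A) _ p)))
  (subst (λ x → not x ∨ isEven (degIn g (compl A) zero) ≡ true) (lookup-map zero not A) (∧-conicalˡ _ _ (∧-conicalʳ (allOddIn g A) _ q)))
  where
  absurd : ∀ a e f → not a ∨ e ≡ true → not a ∨ not e ≡ true →
           not (not a) ∨ not f ≡ true → not (not a) ∨ f ≡ true → ⊥
  absurd true  true  f     _ () _ _
  absurd true  false f     () _ _ _
  absurd false e     true  _ _ () _
  absurd false e     false _ _ _ ()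

-- Complementation, which is translation by `ones`, exchanges the two exclusive alternatives of
-- `goodSplit`. Each is met by `sols (splitSym g)` subsets, so the halving in `Y` is exact.
Y≡sols : ∀ (g : Graph (suc n)) → Y g ≡ sols (splitSym g)
Y≡sols {n} g = trans (cong (_/ 2) twice) (m*n/n≡m (sols (splitSym g)) 2)
  where
  open ≡-Reasoning
  vs = allVecs (suc n)
  twice : count (goodSplit g) vs ≡ sols (splitSym g) * 2
  twice = begin
    count (goodSplit g) vs
      ≡⟨ count≡∑ (goodSplit g) vs ⟩
    ∑ vs (ind ∘ goodSplit g)
      ≡⟨ ∑-cong vs (λ A → ind-∨ _ _ (splits-disjoint g A)) ⟩
    ∑ vs (λ A → ind (evenOdd g A) + ind (allOddIn g A ∧ allEvenIn g (compl A)))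
      ≡⟨ ∑-+ vs _ _ ⟩
    ∑ vs (ind ∘ evenOdd g) + ∑ vs (λ A → ind (allOddIn g A ∧ allEvenIn g (compl A)))
      ≡⟨ cong (∑ vs (ind ∘ evenOdd g) +_) (∑-cong vs λ A → cong ind
           (trans (∧-comm (allOddIn g A) _)
             (trans (cong (λ B → allEvenIn g (compl A) ∧ allOddIn g B) (sym (compl-involutive A)))
               (cong (evenOdd g) (compl≡ones⊕ A))))) ⟩
    ∑ vs (ind ∘ evenOdd g) + ∑ vs (λ A → ind (evenOdd g (ones ⊕ A)))
      ≡⟨ cong (∑ vs (ind ∘ evenOdd g) +_) (∑-translate ones (ind ∘ evenOdd g)) ⟩
    ∑ vs (ind ∘ evenOdd g) + ∑ vs (ind ∘ evenOdd g)
      ≡⟨ cong (λ s → s + s) (∑-cong vs λ A → cong ind (evenOdd≡solves g A)) ⟩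
    sols (splitSym g) + sols (splitSym g)
      ≡⟨ cong (sols (splitSym g) +_) (+-identityʳ _) ⟨
    2 * sols (splitSym g)
      ≡⟨ *-comm 2 (sols (splitSym g)) ⟩
    sols (splitSym g) * 2 ∎

⊕-scale-cancel : ∀ c (t z : Vec Bool n) → scale c (compl t) ⊕ (scale c t ⊕ z) ≡ scale c ones ⊕ z
⊕-scale-cancel c []       []       = refl
⊕-scale-cancel c (t ∷ ts) (z ∷ zs) = cong₂ _∷_
  (by-table 3 (λ c t z → (not t ∧ c) xor (t ∧ c) xor z , c xor z) refl c t z) (⊕-scale-cancel c ts zs)

∧-congˡ-when : ∀ {x y} z → (z ≡ true → x ≡ y) → x ∧ z ≡ y ∧ z
∧-congˡ-when {x} {y} false _ = trans (∧-comm x false) (∧-comm false y)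
∧-congˡ-when {x} {y} true  h = cong (_∧ true) (h refl)

-- The bordered matrix S on the left satisfies S 1 = 1; replacing the first basis vector
-- by 1 turns it into the matrix on the right.
sols-all-ones : ∀ (T : Sym n) → let v = compl (mul T ones) in
  sols (border (not (dot v ones)) v T) ≡ sols (border (not (dot (ones {n}) ones)) ones T)
sols-all-ones {n} T = begin
  sols (border s v T)
    ≡⟨ sols-border s v T ⟩
  ∑ bools (λ c → ∑ (allVecs n) (λ z → ind (eqn s v c z)))
    ≡⟨ ∑-cong bools (λ c → ∑-translate (scale c ones) (λ z → ind (eqn s v c z))) ⟨
  ∑ bools (λ c → ∑ (allVecs n) (λ y → ind (eqn s v c (scale c ones ⊕ y))))
    ≡⟨ ∑-cong bools (λ c → ∑-cong (allVecs n) λ y → cong ind (substitution c y)) ⟩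
  ∑ bools (λ c → ∑ (allVecs n) (λ y → ind (eqn (not π) ones c y)))
    ≡⟨ sols-border (not π) ones T ⟨
  sols (border (not π) ones T) ∎
  where
  open ≡-Reasoning
  v = compl (mul T ones)
  s = not (dot v ones)
  π = dot (ones {n}) ones
  τ = dot ones (diag T)

  eqn : Bool → Vec Bool n → Bool → Vec Bool n → Bool
  eqn s v c z = ((s ∧ c xor dot v z) == s) ∧ eqV (scale c v ⊕ mul T z) (diag T)

  tail : ∀ c y → scale c v ⊕ mul T (scale c ones ⊕ y) ≡ scale c ones ⊕ mul T y
  tail c y = trans
    (cong (scale c v ⊕_) (trans (mul-⊕ T (scale c ones) y) (cong (_⊕ mul T y) (mul-scale T c ones))))
    (⊕-scale-cancel c (mul T ones) (mul T y))

  dot-v : ∀ y → dot v y ≡ dot ones y xor dot ones (mul T y)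
  dot-v y = trans (cong (λ w → dot w y) (compl≡ones⊕ (mul T ones)))
    (trans (dot-⊕ˡ ones (mul T ones) y) (cong (dot ones y xor_) (sym (mul-sym T ones y))))

  dot-v-ones : dot v ones ≡ π xor τ
  dot-v-ones = trans (dot-v ones) (cong (π xor_) (dot-mul-self T ones))

  -- The change of basis also adds all other rows to the first one. The old and new first equations
  -- therefore differ by the sum of the remaining equations, and agree only where those hold: this
  -- is the hypothesis, and `dot-Ty` is that sum.
  head : ∀ c y → scale c ones ⊕ mul T y ≡ diag T →
         ((s ∧ c xor dot v (scale c ones ⊕ y)) == s) ≡ ((not π ∧ c xor dot ones y) == not π)
  head c y e
    rewrite dot-⊕ʳ v (scale c ones) y | dot-scaleʳ c v ones | dot-v-ones | dot-v y =
    trans (cong (λ x → (not (π xor τ) ∧ c xor (π xor τ) ∧ c xor (dot ones y xor x)) == not (π xor τ)) dot-Ty)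
      (by-table 4 (λ π τ c x →
          ((not (π xor τ) ∧ c xor (π xor τ) ∧ c xor (x xor (π ∧ c xor τ))) == not (π xor τ)) ,
          ((not π ∧ c xor x) == not π))
        refl π τ c (dot ones y))
    where
    dot-Ty : dot ones (mul T y) ≡ π ∧ c xor τ
    dot-Ty = begin
      dot ones (mul T y)
        ≡⟨ by-table 2 (λ p q → q , p xor (p xor q)) refl (π ∧ c) (dot ones (mul T y)) ⟩
      π ∧ c xor (π ∧ c xor dot ones (mul T y))
        ≡⟨ cong (λ p → π ∧ c xor (p xor dot ones (mul T y))) (dot-scaleʳ c (ones {n}) ones) ⟨
      π ∧ c xor (dot (ones {n}) (scale c ones) xor dot ones (mul T y))
        ≡⟨ cong (π ∧ c xor_) (dot-⊕ʳ ones (scale c ones) (mul T y)) ⟨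
      π ∧ c xor dot ones (scale c ones ⊕ mul T y)
        ≡⟨ cong (λ w → π ∧ c xor dot ones w) e ⟩
      π ∧ c xor τ ∎

  substitution : ∀ c y → eqn s v c (scale c ones ⊕ y) ≡ eqn (not π) ones c y
  substitution c y = trans
    (cong (λ w → ((s ∧ c xor dot v (scale c ones ⊕ y)) == s) ∧ eqV w (diag T)) (tail c y))
    (∧-congˡ-when (eqV (scale c ones ⊕ mul T y) (diag T)) λ h →
      head c y (eqV-sound (scale c ones ⊕ mul T y) (diag T) h))

-- The degree of `suc i` is its degree in `g` plus the i-th bit of `v`. For fixed `g` the diagonal
-- of the block is thus a translate of `v` and runs over all vectors with it, while the border `v`
-- is recovered from the block because rows sum to 1.
sols-splitSym : ∀ (g : Graph n) v → sols (splitSym (g , v)) ≡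
  sols (border (not (dot (ones {n}) ones)) ones (graphSym ((ones ⊕ mul (adjSym g) ones) ⊕ v) g))
sols-splitSym {n} g v = trans (cong sols shape) (sols-all-ones T)
  where
  open ≡-Reasoning
  d = (ones ⊕ mul (adjSym g) ones) ⊕ v
  T = graphSym d g

  diagonal : ∀ {n} (v x : Vec Bool n) → compl (scale true v ⊕ x) ≡ (ones ⊕ x) ⊕ v
  diagonal []       []       = refl
  diagonal (v ∷ vs) (x ∷ xs) = cong₂ _∷_
    (by-table 2 (λ v x → not (v ∧ true xor x) , not x xor v) refl v x) (diagonal vs xs)

  row : ∀ {n} (v x : Vec Bool n) → compl (zipWith _∧_ ((ones ⊕ x) ⊕ v) ones ⊕ x) ≡ v
  row []       []       = refl
  row (v ∷ vs) (x ∷ xs) = cong₂ _∷_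
    (by-table 2 (λ v x → not ((not x xor v) ∧ true xor x) , v) refl v x) (row vs xs)

  v≡ : compl (mul T ones) ≡ v
  v≡ = trans (cong compl (mul-graphSym d g ones)) (row v (mul (adjSym g) ones))

  shape : splitSym (g , v) ≡ border (not (dot (compl (mul T ones)) ones)) (compl (mul T ones)) T
  shape rewrite v≡ | diagonal v (mul (adjSym g) ones) = refl

count-Y : ∀ n (p : ℕ → Bool) → count (λ g → p (Y g)) (allGraphs (suc n))
          ≡ ∑ (allSyms n) (λ T → ind (p (sols (border (not (dot (ones {n}) ones)) ones T))))
count-Y n p = begin
  count (λ g → p (Y g)) (allGraphs (suc n))
    ≡⟨ count≡∑ _ (allGraphs (suc n)) ⟩
  ∑ (allGraphs (suc n)) (λ g → ind (p (Y g)))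
    ≡⟨ ∑-allGraphs-suc n _ ⟩
  ∑ (allGraphs n) (λ g → ∑ (allVecs n) (λ v → ind (p (Y {suc n} (g , v)))))
    ≡⟨ ∑-cong (allGraphs n) (λ g → ∑-cong (allVecs n) λ v →
         cong (ind ∘ p) (trans (Y≡sols {n} (g , v)) (sols-splitSym g v))) ⟩
  ∑ (allGraphs n) (λ g → ∑ (allVecs n) (λ v → f (graphSym ((ones ⊕ mul (adjSym g) ones) ⊕ v) g)))
    ≡⟨ ∑-cong (allGraphs n) (λ g → ∑-translate (ones ⊕ mul (adjSym g) ones) (λ d → f (graphSym d g))) ⟩
  ∑ (allGraphs n) (λ g → ∑ (allVecs n) (λ d → f (graphSym d g)))
    ≡⟨ ∑-graphSym n f ⟩
  ∑ (allSyms n) f ∎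
  where
  open ≡-Reasoning
  f : Sym n → ℕ
  f T = ind (p (sols (border (not (dot (ones {n}) ones)) ones T)))

-- The form `m * 2` is chosen because `suc m * 2` reduces to two successors; the `2 * m` of the
-- theorem is restored at the very end.
dot-ones-even : ∀ m → dot (ones {m * 2}) ones ≡ false
dot-ones-even zero    = refl
dot-ones-even (suc m) = trans (not-involutive _) (dot-ones-even m)

count-Y-odd : ∀ m (p : ℕ → Bool) → count (λ g → p (Y g)) (allGraphs (suc (m * 2))) ≡ symSum (m * 2) (ind ∘ p)
count-Y-odd m p = trans (count-Y (m * 2) p) (trans
  (cong (λ b → ∑ (allSyms (m * 2)) (λ T → ind (p (sols (border (not b) ones T))))) (dot-ones-even m))
  (∑-pivot (ind ∘ p) (ones {m * 2})))

-- The corner is now 0 and the rest of the row is all ones, so its first entry serves for the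
-- hyperbolic pivot. The remaining size `m * 2` is the same as in the odd case, which is why the two
-- distributions agree.
count-Y-even : ∀ m (p : ℕ → Bool) →
  count (λ g → p (Y g)) (allGraphs (suc (suc (m * 2)))) ≡ 2 ^ suc (m * 2) * symSum (m * 2) (ind ∘ p)
count-Y-even m p = trans (count-Y (suc (m * 2)) p) (trans
  (cong (λ b → ∑ (allSyms (suc (m * 2))) (λ T → ind (p (sols (border (not (not b)) ones T))))) (dot-ones-even m))
  (∑-isotropic (ind ∘ p) zero (ones {m * 2})))

-- The support of the distribution

N : ℕ → ℕ → ℕ
N m x = symSum m (λ y → ind (y ≡ᵇ x))

≡ᵇ-≢ : ∀ {x y} → x ≢ y → (x ≡ᵇ y) ≡ false
≡ᵇ-≢ {x} {y} x≢y with x ≡ᵇ y in eq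
... | false = refl
... | true  = ⊥-elim (x≢y (≡ᵇ⇒≡ x y (subst Bool.T (sym eq) _)))

≡ᵇ-refl : ∀ x → (x ≡ᵇ x) ≡ true
≡ᵇ-refl zero    = refl
≡ᵇ-refl (suc x) = ≡ᵇ-refl x

≡ᵇ-double : ∀ x y → (2 * x ≡ᵇ 2 * y) ≡ (x ≡ᵇ y)
≡ᵇ-double x y with x ≟ y
... | yes refl = trans (≡ᵇ-refl (2 * x)) (sym (≡ᵇ-refl x))
... | no  x≢y  = trans (≡ᵇ-≢ (x≢y ∘ *-cancelˡ-≡ x y 2)) (sym (≡ᵇ-≢ x≢y))

symSum-double : ∀ m x → symSum m (λ y → ind (2 * y ≡ᵇ 2 * x)) ≡ N m x
symSum-double m x = ∑-cong (allSyms m) λ W → cong ind (≡ᵇ-double (sols W) x)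

symSum-double-vanishes : ∀ m x → (∀ x′ → x ≡ 2 * x′ → N m x′ ≡ 0) → symSum m (λ y → ind (2 * y ≡ᵇ x)) ≡ 0
symSum-double-vanishes m x h with 2 ∣? x
... | yes (divides q x≡q*2) = trans (cong (λ x → symSum m (λ y → ind (2 * y ≡ᵇ x))) x≡2*q)
                                    (trans (symSum-double m q) (h q x≡2*q))
  where x≡2*q = trans x≡q*2 (*-comm q 2)
... | no 2∤x = trans (∑-cong (allSyms m) λ W → cong ind (≡ᵇ-≢ λ e → 2∤x (divides (sols W) (trans (sym e) (*-comm 2 (sols W))))))
                     (∑-zero (allSyms m))

-- Induction along `symSum-recursion`, all of whose terms vanish. The doubling raises an exponent by
-- one, whence the bound `suc m` in the companion statement.
N-vanishes : ∀ m x → (∀ k → k ≤ m → x ≢ 2 ^ k) → N m x ≡ 0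
symSum-double-vanishes′ : ∀ m x → (∀ k → k ≤ suc m → x ≢ 2 ^ k) → symSum m (λ y → ind (2 * y ≡ᵇ x)) ≡ 0

N-vanishes zero          x h = cong (λ b → ind b + 0) (≡ᵇ-≢ λ 1≡x → h 0 z≤n (sym 1≡x))
N-vanishes (suc zero)    x h = trans (symSum-one (λ y → ind (y ≡ᵇ x)))
  (cong₂ _+_ (symSum-double-vanishes′ 0 x h) (N-vanishes zero x λ k k≤0 → h k (m≤n⇒m≤1+n k≤0)))
N-vanishes (suc (suc m)) x h = begin
  N (2 + m) x
    ≡⟨ +-identityʳ _ ⟨
  N (2 + m) x + 0
    ≡⟨ cong (N (2 + m) x +_) (trans (cong (2 ^ suc m *_) N₀) (*-zeroʳ (2 ^ suc m))) ⟨
  N (2 + m) x + 2 ^ suc m * N m x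
    ≡⟨ symSum-recursion m (λ y → ind (y ≡ᵇ x)) ⟩
  symSum (suc m) (λ y → ind (2 * y ≡ᵇ x)) + 2 ^ suc m * (2 ^ suc m * N m x) + 2 ^ suc m * N (suc m) x
    ≡⟨ cong₂ _+_ (cong₂ _+_ (symSum-double-vanishes′ (suc m) x h) (cong (λ z → 2 ^ suc m * (2 ^ suc m * z)) N₀))
                 (cong (2 ^ suc m *_) (N-vanishes (suc m) x λ k k≤ → h k (m≤n⇒m≤1+n k≤))) ⟩
  2 ^ suc m * (2 ^ suc m * 0) + 2 ^ suc m * 0
    ≡⟨ cong₂ _+_ (trans (cong (2 ^ suc m *_) (*-zeroʳ (2 ^ suc m))) (*-zeroʳ (2 ^ suc m))) (*-zeroʳ (2 ^ suc m)) ⟩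
  0 ∎
  where
  open ≡-Reasoning
  N₀ = N-vanishes m x λ k k≤m → h k (m≤n⇒m≤1+n (m≤n⇒m≤1+n k≤m))

symSum-double-vanishes′ m x h = symSum-double-vanishes m x λ x′ x≡2x′ →
  N-vanishes m x′ λ k k≤m x′≡2^k → h (suc k) (s≤s k≤m) (trans x≡2x′ (cong (2 *_) x′≡2^k))

N-high : ∀ {m k} → m < k → N m (2 ^ k) ≡ 0
N-high {m} {k} m<k = N-vanishes m (2 ^ k) λ j j≤m e →
  <⇒≢ (^-monoʳ-< 2 (s≤s (s≤s z≤n)) (≤-<-trans j≤m m<k)) (sym e)

2*≢1 : ∀ x → 2 * x ≢ 1
2*≢1 x e with () ← m*n≡1⇒m≡1 2 x e

-- Rational arithmetic

coprime-1 : ∀ n → Coprime n 1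
coprime-1 n = coprime-sym (1-coprimeTo n)

-- `fromℕ` normalises through a gcd that is stuck on a variable; the constructor form exposes
-- numerator and denominator.
fromℕ≡mkℚ : ∀ n → fromℕ n ≡ mkℚ (ℤ.+ n) 0 (coprime-1 n)
fromℕ≡mkℚ n = ℚ.normalize-coprime (coprime-1 n)

fromℕ-injective : ∀ {a b} → fromℕ a ≡ fromℕ b → a ≡ b
fromℕ-injective {a} {b} e =
  ℤ.+-injective (cong ℚ.numerator (trans (sym (fromℕ≡mkℚ a)) (trans e (fromℕ≡mkℚ b))))

fromℕ-+ : ∀ a b → fromℕ (a + b) ≡ fromℕ a ℚ.+ fromℕ b
fromℕ-+ a b rewrite fromℕ≡mkℚ a | fromℕ≡mkℚ b =
  cong (ℚ._/ 1) (sym (cong₂ ℤ._+_ (ℤ.*-identityʳ (ℤ.+ a)) (ℤ.*-identityʳ (ℤ.+ b))))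

fromℕ-* : ∀ a b → fromℕ (a * b) ≡ fromℕ a ℚ.* fromℕ b
fromℕ-* a b rewrite fromℕ≡mkℚ a | fromℕ≡mkℚ b = cong (ℚ._/ 1) (ℤ.pos-* a b)

2^ℚ : ℕ → ℚ
2^ℚ k = fromℕ (2 ^ k)

2^ℚ-suc : ∀ k → 2^ℚ (suc k) ≡ 2^ℚ k ℚ.+ 2^ℚ k
2^ℚ-suc k = trans (cong (λ x → fromℕ (2 ^ k + x)) (+-identityʳ (2 ^ k))) (fromℕ-+ (2 ^ k) (2 ^ k))

2^ℚ-half : ∀ k → 2^ℚ k ℚ.* (half ^ℚ k) ≡ 1ℚ
2^ℚ-half zero    = refl
2^ℚ-half (suc k) = begin
  2^ℚ (suc k) ℚ.* (half ℚ.* h)          ≡⟨ cong (ℚ._* (half ℚ.* h)) (2^ℚ-suc k) ⟩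
  (q ℚ.+ q) ℚ.* (half ℚ.* h)            ≡⟨ solve 3 (λ q t h → (q :+ q) :* (t :* h) := (t :+ t) :* (q :* h)) refl q half h ⟩
  -- `half ℚ.+ half` evaluates to `1ℚ`.
  1ℚ ℚ.* (q ℚ.* h)                      ≡⟨ ℚ.*-identityˡ (q ℚ.* h) ⟩
  q ℚ.* h                               ≡⟨ 2^ℚ-half k ⟩
  1ℚ                                    ∎
  where
  open ≡-Reasoning
  open ℚ-Solver.+-*-Solver
  q = 2^ℚ k
  h = half ^ℚ k

2^ℚ-+-half : ∀ k j → 2^ℚ (k + j) ℚ.* (half ^ℚ j) ≡ 2^ℚ k
2^ℚ-+-half k j = begin
  2^ℚ (k + j) ℚ.* (half ^ℚ j)
    ≡⟨ cong (ℚ._* (half ^ℚ j)) (trans (cong fromℕ (^-distribˡ-+-* 2 k j)) (fromℕ-* (2 ^ k) (2 ^ j))) ⟩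
  (2^ℚ k ℚ.* 2^ℚ j) ℚ.* (half ^ℚ j)
    ≡⟨ ℚ.*-assoc (2^ℚ k) (2^ℚ j) (half ^ℚ j) ⟩
  2^ℚ k ℚ.* (2^ℚ j ℚ.* (half ^ℚ j))
    ≡⟨ cong (2^ℚ k ℚ.*_) (2^ℚ-half j) ⟩
  2^ℚ k ℚ.* 1ℚ
    ≡⟨ ℚ.*-identityʳ (2^ℚ k) ⟩
  2^ℚ k ∎
  where open ≡-Reasoning

half-+ : ∀ a b → half ^ℚ (a + b) ≡ (half ^ℚ a) ℚ.* (half ^ℚ b)
half-+ zero    b = sym (ℚ.*-identityˡ (half ^ℚ b))
half-+ (suc a) b = trans (cong (half ℚ.*_) (half-+ a b)) (sym (ℚ.*-assoc half (half ^ℚ a) (half ^ℚ b)))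

inv-inverse : ∀ p → p ≢ 0ℚ → inv p ℚ.* p ≡ 1ℚ
inv-inverse p p≢0 with p ℚ.≟ 0ℚ
... | yes p≡0 = ⊥-elim (p≢0 p≡0)
... | no  p≢0′ = ℚ.*-inverseˡ p {{≢-nonZero p≢0′}}

oneMinus : ℕ → ℚ
oneMinus i = 1ℚ ℚ.- (half ^ℚ (2 * i))

-- Otherwise 2 ^ (2 * suc i) = 1, although it is twice 2 ^ (i + suc (i + 0)). This keeps `inv` away
-- from its default value at 0.
oneMinus≢0 : ∀ i → oneMinus (suc i) ≢ 0ℚ
oneMinus≢0 i e = 2*≢1 (2 ^ (i + suc (i + 0))) (fromℕ-injective (begin
  2^ℚ j                     ≡⟨ ℚ.*-identityʳ (2^ℚ j) ⟨
  2^ℚ j ℚ.* 1ℚ              ≡⟨ cong (2^ℚ j ℚ.*_) x≡1 ⟨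
  2^ℚ j ℚ.* (half ^ℚ j)     ≡⟨ 2^ℚ-half j ⟩
  fromℕ 1                   ∎))
  where
  open ≡-Reasoning
  open ℚ-Solver.+-*-Solver
  j = 2 * suc i
  x = half ^ℚ j
  x≡1 : x ≡ 1ℚ
  x≡1 = begin
    x                        ≡⟨ solve 1 (λ x → x := con 1ℚ :+ :- (con 1ℚ :+ :- x)) refl x ⟩
    1ℚ ℚ.- (1ℚ ℚ.- x)        ≡⟨ cong (λ y → 1ℚ ℚ.- y) e ⟩
    1ℚ                       ∎

-- Products over intervals

prodN : ℕ → ℕ → (ℕ → ℚ) → ℚ
prodN zero    i f = 1ℚ
prodN (suc n) i f = f i ℚ.* prodN n (suc i) f

-- The local function of prodFromTo has no name outside Defs: the underscore below is solved
-- to it by unification, since after the with-abstractions it is applied to distinct variables.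
mutual
  prodFromTo≡prodN : ∀ a b f → prodFromTo a b f ≡ prodN (suc b ∸ a) a f
  prodFromTo≡prodN a b f with suc b ∸ a
  ... | zero = refl
  ... | suc w with suc a
  ...   | i = cong (f a ℚ.*_) (go≡prodN a b f w i)

  go≡prodN : ∀ a b f n i → _ ≡ prodN n i f
  go≡prodN a b f zero    i = refl
  go≡prodN a b f (suc n) i = cong (f i ℚ.*_) (go≡prodN a b f n (suc i))

prodN-snoc : ∀ n i f → prodN (suc n) i f ≡ prodN n i f ℚ.* f (n + i)
prodN-snoc zero    i f = trans (ℚ.*-identityʳ (f i)) (sym (ℚ.*-identityˡ (f i)))
prodN-snoc (suc n) i f = trans
  (cong (f i ℚ.*_) (trans (prodN-snoc n (suc i) f) (cong (λ j → prodN n (suc i) f ℚ.* f j) (+-suc n i))))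
  (sym (ℚ.*-assoc (f i) (prodN n (suc i) f) (f (suc n + i))))

-- The explicit formula, for matrices of size k + r

minusOne : ℕ → ℚ
minusOne i = 2^ℚ i ℚ.- 1ℚ

h : ℕ → ℚ
h s = prodN s 1 (λ i → inv (oneMinus i))

h-suc : ∀ s → h (suc s) ℚ.* oneMinus (suc s) ≡ h s
h-suc s = begin
  h (suc s) ℚ.* oneMinus (suc s)
    ≡⟨ cong (ℚ._* oneMinus (suc s)) (trans (prodN-snoc s 1 (λ i → inv (oneMinus i))) (cong (λ i → h s ℚ.* inv (oneMinus i)) (+-comm s 1))) ⟩
  h s ℚ.* inv (oneMinus (suc s)) ℚ.* oneMinus (suc s)
    ≡⟨ ℚ.*-assoc (h s) (inv (oneMinus (suc s))) (oneMinus (suc s)) ⟩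
  h s ℚ.* (inv (oneMinus (suc s)) ℚ.* oneMinus (suc s))
    ≡⟨ cong (h s ℚ.*_) (inv-inverse (oneMinus (suc s)) (oneMinus≢0 s)) ⟩
  h s ℚ.* 1ℚ
    ≡⟨ ℚ.*-identityʳ (h s) ⟩
  h s ∎
  where open ≡-Reasoning

-- The classical number of symmetric 𝔽₂ matrices of corank `k` and rank `r`.
formulaN : ℕ → ℕ → ℚ
formulaN k r = h ⌊ r /2⌋ ℚ.* prodN r (suc k) minusOne

halving : ∀ r → (⌊ suc r /2⌋ ≡ ⌊ r /2⌋ × suc r ≡ 2 * ⌊ r /2⌋ + 1)
              ⊎ (⌊ suc r /2⌋ ≡ suc ⌊ r /2⌋ × suc r ≡ 2 * suc ⌊ r /2⌋)
halving zero          = inj₁ (refl , refl)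
halving (suc zero)    = inj₂ (refl , refl)
halving (suc (suc r)) with halving r
... | inj₁ (p , q) = inj₁ (cong suc p , trans (cong (2 +_) q) (cong (λ x → suc (x + 1)) (sym (+-suc ⌊ r /2⌋ _))))
... | inj₂ (p , q) = inj₂ (cong suc p , trans (cong (2 +_) q) (cong suc (sym (+-suc (suc ⌊ r /2⌋) _))))

2^ℚ-oneMinus : ∀ k i → 2^ℚ (k + 2 * i) ℚ.* oneMinus i ≡ 2^ℚ (k + 2 * i) ℚ.- 2^ℚ k
2^ℚ-oneMinus k i = trans
  (solve 2 (λ q x → q :* (con 1ℚ :+ :- x) := q :+ :- (q :* x)) refl (2^ℚ (k + 2 * i)) (half ^ℚ (2 * i)))
  (cong (λ x → 2^ℚ (k + 2 * i) ℚ.- x) (2^ℚ-+-half k (2 * i)))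
  where open ℚ-Solver.+-*-Solver

-- This is what the recursion demands of `h` once common factors are removed. With s = ⌊ r /2⌋, the
-- factor 1 - 2^(-2(s+1)) that turns `h (suc s)` into `h s` comes from 2q - 2^k = 2q (1 -
-- 2^(-2(s+1))) for even `r`, and from q - 2^k = q (1 - 2^(-2(s+1))) for odd `r`.
h-relation : ∀ k r → let q = 2^ℚ (k + suc r) in
  h (suc ⌊ r /2⌋) ℚ.* ((q ℚ.+ q) ℚ.- 2^ℚ k) ≡ q ℚ.* (h ⌊ suc r /2⌋ ℚ.+ h ⌊ r /2⌋)
h-relation k r with halving r
... | inj₁ (p , e) = begin
  h₁ ℚ.* ((q ℚ.+ q) ℚ.- 2^ℚ k)
    ≡⟨ cong (λ x → h₁ ℚ.* (x ℚ.- 2^ℚ k)) q+q ⟩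
  h₁ ℚ.* (2^ℚ (k + 2 * suc s) ℚ.- 2^ℚ k)
    ≡⟨ cong (h₁ ℚ.*_) (2^ℚ-oneMinus k (suc s)) ⟨
  h₁ ℚ.* (2^ℚ (k + 2 * suc s) ℚ.* oneMinus (suc s))
    ≡⟨ cong (λ x → h₁ ℚ.* (x ℚ.* oneMinus (suc s))) q+q ⟨
  h₁ ℚ.* ((q ℚ.+ q) ℚ.* oneMinus (suc s))
    ≡⟨ solve 3 (λ a q d → a :* ((q :+ q) :* d) := q :* (a :* d :+ a :* d)) refl h₁ q (oneMinus (suc s)) ⟩
  q ℚ.* (h₁ ℚ.* oneMinus (suc s) ℚ.+ h₁ ℚ.* oneMinus (suc s))
    ≡⟨ cong (λ x → q ℚ.* (x ℚ.+ x)) (h-suc s) ⟩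
  q ℚ.* (h s ℚ.+ h s)
    ≡⟨ cong (λ x → q ℚ.* (h x ℚ.+ h s)) p ⟨
  q ℚ.* (h ⌊ suc r /2⌋ ℚ.+ h s) ∎
  where
  open ≡-Reasoning
  open ℚ-Solver.+-*-Solver
  s = ⌊ r /2⌋
  h₁ = h (suc s)
  q = 2^ℚ (k + suc r)
  index : suc (k + suc r) ≡ k + 2 * suc s
  index = trans (sym (+-suc k (suc r))) (cong (k +_) (trans (cong suc (trans e (+-comm (2 * s) 1)))
            (cong suc (sym (+-suc s (s + 0))))))
  q+q : q ℚ.+ q ≡ 2^ℚ (k + 2 * suc s)
  q+q = trans (sym (2^ℚ-suc (k + suc r))) (cong 2^ℚ index)
... | inj₂ (p , e) = begin
  h₁ ℚ.* ((q ℚ.+ q) ℚ.- 2^ℚ k)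
    ≡⟨ solve 3 (λ a q x → a :* ((q :+ q) :+ :- x) := a :* q :+ a :* (q :+ :- x)) refl h₁ q (2^ℚ k) ⟩
  h₁ ℚ.* q ℚ.+ h₁ ℚ.* (q ℚ.- 2^ℚ k)
    ≡⟨ cong (λ x → h₁ ℚ.* q ℚ.+ h₁ ℚ.* x)
         (subst (λ j → 2^ℚ (k + j) ℚ.* oneMinus (suc s) ≡ 2^ℚ (k + j) ℚ.- 2^ℚ k) (sym e) (2^ℚ-oneMinus k (suc s))) ⟨
  h₁ ℚ.* q ℚ.+ h₁ ℚ.* (q ℚ.* oneMinus (suc s))
    ≡⟨ solve 3 (λ a q d → a :* q :+ a :* (q :* d) := q :* (a :+ a :* d)) refl h₁ q (oneMinus (suc s)) ⟩
  q ℚ.* (h₁ ℚ.+ h₁ ℚ.* oneMinus (suc s))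
    ≡⟨ cong₂ (λ x y → q ℚ.* (x ℚ.+ y)) (cong h (sym p)) (h-suc s) ⟩
  q ℚ.* (h ⌊ suc r /2⌋ ℚ.+ h s) ∎
  where
  open ≡-Reasoning
  open ℚ-Solver.+-*-Solver
  s = ⌊ r /2⌋
  h₁ = h (suc s)
  q = 2^ℚ (k + suc r)

-- The explicit formula satisfies the recursion

Nℚ : ℕ → ℕ → ℚ
Nℚ m k = fromℕ (N m (2 ^ k))

doubledℚ : ℕ → ℕ → ℚ
doubledℚ m k = fromℕ (symSum m (λ y → ind (2 * y ≡ᵇ 2 ^ k)))

Formula : ℕ → Set
Formula m = ∀ k r → k + r ≡ m → Nℚ m k ≡ formulaN k r

doubledℚ-zero : ∀ m → doubledℚ m 0 ≡ 0ℚ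
doubledℚ-zero m = cong fromℕ (symSum-double-vanishes m 1 λ x′ e → ⊥-elim (2*≢1 x′ (sym e)))

doubledℚ-suc : ∀ m k → doubledℚ m (suc k) ≡ Nℚ m k
doubledℚ-suc m k = cong fromℕ (symSum-double m (2 ^ k))

-- This is the formula at corank k - 1 and rank r + 1 with its first factor split off. At k = 0 that
-- factor `minusOne 0` is zero, so the same expression covers the case where 2^k is odd.
doubledℚ-formula : ∀ m → Formula m → ∀ k r → k + r ≡ m →
  doubledℚ m k ≡ h ⌊ suc r /2⌋ ℚ.* (minusOne k ℚ.* prodN r (suc k) minusOne)
doubledℚ-formula m hyp zero    r e = trans (doubledℚ-zero m)
  (sym (trans (cong (h ⌊ suc r /2⌋ ℚ.*_) (ℚ.*-zeroˡ (prodN r 1 minusOne))) (ℚ.*-zeroʳ (h ⌊ suc r /2⌋))))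
doubledℚ-formula m hyp (suc k) r e = trans (doubledℚ-suc m k) (hyp k (suc r) (trans (+-suc k r) e))

symSum-recursionℚ : ∀ m k → let q = 2^ℚ (suc m) in
  Nℚ (2 + m) k ≡ doubledℚ (suc m) k ℚ.+ q ℚ.* (q ℚ.* Nℚ m k) ℚ.+ q ℚ.* Nℚ (suc m) k ℚ.- q ℚ.* Nℚ m k
symSum-recursionℚ m k = begin
  a
    ≡⟨ solve 2 (λ a x → a := (a :+ x) :+ :- x) refl a (q ℚ.* b) ⟩
  (a ℚ.+ q ℚ.* b) ℚ.- q ℚ.* b
    ≡⟨ cong (λ x → (a ℚ.+ x) ℚ.- q ℚ.* b) (fromℕ-* Q N₀) ⟨
  (a ℚ.+ fromℕ (Q * N₀)) ℚ.- q ℚ.* b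
    ≡⟨ cong (ℚ._- q ℚ.* b) (fromℕ-+ (N (2 + m) (2 ^ k)) (Q * N₀)) ⟨
  fromℕ (N (2 + m) (2 ^ k) + Q * N₀) ℚ.- q ℚ.* b
    ≡⟨ cong (λ x → fromℕ x ℚ.- q ℚ.* b) (symSum-recursion m (λ y → ind (y ≡ᵇ 2 ^ k))) ⟩
  fromℕ (D + Q * (Q * N₀) + Q * N₁) ℚ.- q ℚ.* b
    ≡⟨ cong (ℚ._- q ℚ.* b) (trans (fromℕ-+ (D + Q * (Q * N₀)) (Q * N₁))
         (cong₂ ℚ._+_ (trans (fromℕ-+ D (Q * (Q * N₀)))
                        (cong (fromℕ D ℚ.+_) (trans (fromℕ-* Q (Q * N₀)) (cong (q ℚ.*_) (fromℕ-* Q N₀)))))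
                      (fromℕ-* Q N₁))) ⟩
  fromℕ D ℚ.+ q ℚ.* (q ℚ.* b) ℚ.+ q ℚ.* fromℕ N₁ ℚ.- q ℚ.* b ∎
  where
  open ≡-Reasoning
  open ℚ-Solver.+-*-Solver
  Q = 2 ^ suc m
  N₀ = N m (2 ^ k)
  D = symSum (suc m) (λ y → ind (2 * y ≡ᵇ 2 ^ k))
  N₁ = N (suc m) (2 ^ k)
  q = fromℕ Q
  a = Nℚ (2 + m) k
  b = fromℕ N₀

-- For rank 0 here, and rank 1 in the next lemma, the size-`m` term would need rank r - 2 < 0; it
-- vanishes by `N-high`.
N-formula-corank-all : ∀ m → Formula (suc m) → Nℚ (2 + m) (2 + m) ≡ 1ℚ
N-formula-corank-all m hyp = begin
  Nℚ (2 + m) (2 + m)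
    ≡⟨ symSum-recursionℚ m (2 + m) ⟩
  doubledℚ (suc m) (2 + m) ℚ.+ q ℚ.* (q ℚ.* Nℚ m (2 + m)) ℚ.+ q ℚ.* Nℚ (suc m) (2 + m) ℚ.- q ℚ.* Nℚ m (2 + m)
    ≡⟨ cong₂ (λ x y → x ℚ.+ q ℚ.* (q ℚ.* y) ℚ.+ q ℚ.* Nℚ (suc m) (2 + m) ℚ.- q ℚ.* y)
         (trans (doubledℚ-suc (suc m) (suc m)) (hyp (suc m) 0 (+-identityʳ (suc m))))
         (cong fromℕ (N-high {m} {2 + m} (m≤n⇒m≤1+n (n<1+n m)))) ⟩
  1ℚ ℚ.+ q ℚ.* (q ℚ.* 0ℚ) ℚ.+ q ℚ.* Nℚ (suc m) (2 + m) ℚ.- q ℚ.* 0ℚ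
    ≡⟨ cong (λ x → 1ℚ ℚ.+ q ℚ.* (q ℚ.* 0ℚ) ℚ.+ q ℚ.* x ℚ.- q ℚ.* 0ℚ) (cong fromℕ (N-high {suc m} {2 + m} (n<1+n (suc m)))) ⟩
  1ℚ ℚ.+ q ℚ.* (q ℚ.* 0ℚ) ℚ.+ q ℚ.* 0ℚ ℚ.- q ℚ.* 0ℚ
    ≡⟨ solve 1 (λ q → con 1ℚ :+ q :* (q :* con 0ℚ) :+ q :* con 0ℚ :+ :- (q :* con 0ℚ) := con 1ℚ) refl q ⟩
  1ℚ ∎
  where
  open ≡-Reasoning
  open ℚ-Solver.+-*-Solver
  q = 2^ℚ (suc m)

N-formula-rank-one : ∀ m → Formula (suc m) → Nℚ (2 + m) (suc m) ≡ formulaN (suc m) 1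
N-formula-rank-one m hyp = begin
  Nℚ (2 + m) (suc m)
    ≡⟨ symSum-recursionℚ m (suc m) ⟩
  doubledℚ (suc m) (suc m) ℚ.+ q ℚ.* (q ℚ.* Nℚ m (suc m)) ℚ.+ q ℚ.* Nℚ (suc m) (suc m) ℚ.- q ℚ.* Nℚ m (suc m)
    ≡⟨ cong₂ (λ x y → x ℚ.+ q ℚ.* (q ℚ.* Nℚ m (suc m)) ℚ.+ q ℚ.* y ℚ.- q ℚ.* Nℚ m (suc m))
         (doubledℚ-formula (suc m) hyp (suc m) 0 (+-identityʳ (suc m)))
         (hyp (suc m) 0 (+-identityʳ (suc m))) ⟩
  1ℚ ℚ.* ((q ℚ.- 1ℚ) ℚ.* 1ℚ) ℚ.+ q ℚ.* (q ℚ.* Nℚ m (suc m)) ℚ.+ q ℚ.* 1ℚ ℚ.- q ℚ.* Nℚ m (suc m)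
    ≡⟨ cong (λ y → 1ℚ ℚ.* ((q ℚ.- 1ℚ) ℚ.* 1ℚ) ℚ.+ q ℚ.* (q ℚ.* y) ℚ.+ q ℚ.* 1ℚ ℚ.- q ℚ.* y)
         (cong fromℕ (N-high {m} {suc m} (n<1+n m))) ⟩
  1ℚ ℚ.* ((q ℚ.- 1ℚ) ℚ.* 1ℚ) ℚ.+ q ℚ.* (q ℚ.* 0ℚ) ℚ.+ q ℚ.* 1ℚ ℚ.- q ℚ.* 0ℚ
    ≡⟨ solve 1 (λ q → con 1ℚ :* ((q :+ :- con 1ℚ) :* con 1ℚ) :+ q :* (q :* con 0ℚ) :+ q :* con 1ℚ :+ :- (q :* con 0ℚ)
                   := con 1ℚ :* (((q :+ q) :+ :- con 1ℚ) :* con 1ℚ)) refl q ⟩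
  1ℚ ℚ.* (((q ℚ.+ q) ℚ.- 1ℚ) ℚ.* 1ℚ)
    ≡⟨ cong (λ x → 1ℚ ℚ.* ((x ℚ.- 1ℚ) ℚ.* 1ℚ)) (2^ℚ-suc (suc m)) ⟨
  formulaN (suc m) 1 ∎
  where
  open ≡-Reasoning
  open ℚ-Solver.+-*-Solver
  q = 2^ℚ (suc m)

-- All terms share `P * (q - 1)`, the size-`m` ones through q² - q. There remains h₁ (2^k - 1) + q
-- (h′ + h₀); `h-relation` turns the second part into h₁ (2q - 2^k), so 2^k cancels and the new last
-- factor 2q - 1 appears.
N-formula-step : ∀ m → Formula m → Formula (suc m) → ∀ k r → k + suc r ≡ suc m →
                 Nℚ (2 + m) k ≡ formulaN k (2 + r)
N-formula-step m hyp₀ hyp₁ k r e = begin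
  Nℚ (2 + m) k
    ≡⟨ symSum-recursionℚ m k ⟩
  doubledℚ (suc m) k ℚ.+ q ℚ.* (q ℚ.* Nℚ m k) ℚ.+ q ℚ.* Nℚ (suc m) k ℚ.- q ℚ.* Nℚ m k
    ≡⟨ cong₂ (λ x y → x ℚ.+ q ℚ.* (q ℚ.* y) ℚ.+ q ℚ.* Nℚ (suc m) k ℚ.- q ℚ.* y)
         (trans (doubledℚ-formula (suc m) hyp₁ k (suc r) e) (cong (λ x → h₁ ℚ.* (minusOne k ℚ.* x)) P₁))
         (hyp₀ k r (suc-injective (trans (sym (+-suc k r)) e))) ⟩
  h₁ ℚ.* ((qk ℚ.- 1ℚ) ℚ.* (P ℚ.* (q ℚ.- 1ℚ))) ℚ.+ q ℚ.* (q ℚ.* (h₀ ℚ.* P)) ℚ.+ q ℚ.* Nℚ (suc m) k ℚ.- q ℚ.* (h₀ ℚ.* P)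
    ≡⟨ cong (λ x → h₁ ℚ.* ((qk ℚ.- 1ℚ) ℚ.* (P ℚ.* (q ℚ.- 1ℚ))) ℚ.+ q ℚ.* (q ℚ.* (h₀ ℚ.* P)) ℚ.+ q ℚ.* x ℚ.- q ℚ.* (h₀ ℚ.* P))
         (trans (hyp₁ k (suc r) e) (cong (h′ ℚ.*_) P₁)) ⟩
  h₁ ℚ.* ((qk ℚ.- 1ℚ) ℚ.* (P ℚ.* (q ℚ.- 1ℚ))) ℚ.+ q ℚ.* (q ℚ.* (h₀ ℚ.* P)) ℚ.+ q ℚ.* (h′ ℚ.* (P ℚ.* (q ℚ.- 1ℚ))) ℚ.- q ℚ.* (h₀ ℚ.* P)
    ≡⟨ solve 6 (λ q qk h₀ h′ h₁ P →
         h₁ :* ((qk :+ :- con 1ℚ) :* (P :* (q :+ :- con 1ℚ))) :+ q :* (q :* (h₀ :* P)) :+ q :* (h′ :* (P :* (q :+ :- con 1ℚ))) :+ :- (q :* (h₀ :* P))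
         := (P :* (q :+ :- con 1ℚ)) :* (h₁ :* (qk :+ :- con 1ℚ) :+ q :* (h′ :+ h₀))) refl q qk h₀ h′ h₁ P ⟩
  (P ℚ.* (q ℚ.- 1ℚ)) ℚ.* (h₁ ℚ.* (qk ℚ.- 1ℚ) ℚ.+ q ℚ.* (h′ ℚ.+ h₀))
    ≡⟨ cong (λ x → (P ℚ.* (q ℚ.- 1ℚ)) ℚ.* (h₁ ℚ.* (qk ℚ.- 1ℚ) ℚ.+ x))
         (subst (λ j → h₁ ℚ.* ((2^ℚ j ℚ.+ 2^ℚ j) ℚ.- qk) ≡ 2^ℚ j ℚ.* (h′ ℚ.+ h₀)) e (h-relation k r)) ⟨
  (P ℚ.* (q ℚ.- 1ℚ)) ℚ.* (h₁ ℚ.* (qk ℚ.- 1ℚ) ℚ.+ h₁ ℚ.* ((q ℚ.+ q) ℚ.- qk))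
    ≡⟨ solve 4 (λ q qk h₁ P →
         (P :* (q :+ :- con 1ℚ)) :* (h₁ :* (qk :+ :- con 1ℚ) :+ h₁ :* ((q :+ q) :+ :- qk))
         := h₁ :* ((P :* (q :+ :- con 1ℚ)) :* ((q :+ q) :+ :- con 1ℚ))) refl q qk h₁ P ⟩
  h₁ ℚ.* ((P ℚ.* (q ℚ.- 1ℚ)) ℚ.* ((q ℚ.+ q) ℚ.- 1ℚ))
    ≡⟨ cong (h₁ ℚ.*_) P₂ ⟨
  formulaN k (2 + r) ∎
  where
  open ≡-Reasoning
  open ℚ-Solver.+-*-Solver
  q = 2^ℚ (suc m)
  qk = 2^ℚ k
  h₀ = h ⌊ r /2⌋
  h′ = h ⌊ suc r /2⌋
  h₁ = h (suc ⌊ r /2⌋)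
  P = prodN r (suc k) minusOne

  index : r + suc k ≡ suc m
  index = trans (+-suc r k) (trans (cong suc (+-comm r k)) (trans (sym (+-suc k r)) e))

  P₁ : prodN (suc r) (suc k) minusOne ≡ P ℚ.* (q ℚ.- 1ℚ)
  P₁ = trans (prodN-snoc r (suc k) minusOne) (cong (λ j → P ℚ.* minusOne j) index)

  P₂ : prodN (2 + r) (suc k) minusOne ≡ (P ℚ.* (q ℚ.- 1ℚ)) ℚ.* ((q ℚ.+ q) ℚ.- 1ℚ)
  P₂ = trans (prodN-snoc (suc r) (suc k) minusOne)
    (cong₂ ℚ._*_ P₁ (trans (cong (λ j → minusOne (suc j)) index) (cong (ℚ._- 1ℚ) (2^ℚ-suc (suc m)))))

N-formula : ∀ m → Formula m
N-formula zero          zero          zero          e = refl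
N-formula (suc zero)    zero          (suc zero)    e = cong fromℕ (symSum-one (λ y → ind (y ≡ᵇ 1)))
N-formula (suc zero)    (suc zero)    zero          e = cong fromℕ (symSum-one (λ y → ind (y ≡ᵇ 2)))
N-formula (suc zero)    (suc zero)    (suc r)       ()
N-formula (suc zero)    (suc (suc k)) r             ()
N-formula (suc (suc m)) k             zero          e =
  subst (λ k → Nℚ (2 + m) k ≡ formulaN k 0) (trans (sym e) (+-identityʳ k)) (N-formula-corank-all m (N-formula (suc m)))
N-formula (suc (suc m)) k             (suc zero)    e =
  subst (λ k → Nℚ (2 + m) k ≡ formulaN k 1) (suc-injective (trans (sym e) (+-comm k 1))) (N-formula-rank-one m (N-formula (suc m)))
N-formula (suc (suc m)) k             (suc (suc r)) e =
  N-formula-step m (N-formula m) (N-formula (suc m)) k r (suc-injective (trans (sym (+-suc k (suc r))) e))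

-- From matrix counts to probabilities

n/2≡⌊n/2⌋ : ∀ n → n / 2 ≡ ⌊ n /2⌋
n/2≡⌊n/2⌋ zero          = refl
n/2≡⌊n/2⌋ (suc zero)    = refl
n/2≡⌊n/2⌋ (suc (suc n)) = trans (+-distrib-/-∣ˡ n (∣-refl {2})) (cong suc (n/2≡⌊n/2⌋ n))

formula≡formulaN : ∀ k r → formula (suc (k + r)) k ≡ (half ^ℚ (suc (k + r) C 2)) ℚ.* formulaN k r
formula≡formulaN k r = begin
  formula (suc (k + r)) k
    ≡⟨ cong₂ (λ x y → p ℚ.* x ℚ.* y) first second ⟩
  p ℚ.* h ⌊ r /2⌋ ℚ.* prodN r (suc k) minusOne
    ≡⟨ ℚ.*-assoc p (h ⌊ r /2⌋) (prodN r (suc k) minusOne) ⟩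
  p ℚ.* formulaN k r ∎
  where
  open ≡-Reasoning
  p = half ^ℚ (suc (k + r) C 2)

  first : prodFromTo 1 ((k + r ∸ k) / 2) (λ i → inv (oneMinus i)) ≡ h ⌊ r /2⌋
  first = trans (cong (λ s → prodFromTo 1 s (λ i → inv (oneMinus i)))
                  (trans (cong (_/ 2) (m+n∸m≡n k r)) (n/2≡⌊n/2⌋ r)))
                (prodFromTo≡prodN 1 ⌊ r /2⌋ (λ i → inv (oneMinus i)))

  second : prodFromTo (k + 1) (k + r) minusOne ≡ prodN r (suc k) minusOne
  second = trans (cong (λ j → prodFromTo j (k + r) minusOne) (+-comm k 1))
    (trans (prodFromTo≡prodN (suc k) (k + r) minusOne)
           (cong (λ l → prodN l (suc k) minusOne) (m+n∸m≡n k r)))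

PrY-odd : ∀ m k → k < suc (m * 2) → PrY (suc (m * 2)) (2 ^ k) ≡ formula (suc (m * 2)) k
PrY-odd m k (s≤s k≤n) = begin
  PrY (suc (m * 2)) (2 ^ k)
    ≡⟨ cong (λ c → fromℕ c ℚ.* p) (count-Y-odd m (_≡ᵇ 2 ^ k)) ⟩
  Nℚ (m * 2) k ℚ.* p
    ≡⟨ cong (ℚ._* p) (N-formula (m * 2) k r e) ⟩
  formulaN k r ℚ.* p
    ≡⟨ ℚ.*-comm (formulaN k r) p ⟩
  p ℚ.* formulaN k r
    ≡⟨ subst (λ n → formula (suc n) k ≡ (half ^ℚ (suc n C 2)) ℚ.* formulaN k r) e (formula≡formulaN k r) ⟨
  formula (suc (m * 2)) k ∎
  where
  open ≡-Reasoning
  p = half ^ℚ (suc (m * 2) C 2)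
  r = m * 2 ∸ k
  e : k + r ≡ m * 2
  e = m+[n∸m]≡n k≤n

PrY-odd-support : ∀ m x → (∀ k → k < suc (m * 2) → x ≢ 2 ^ k) → PrY (suc (m * 2)) x ≡ 0ℚ
PrY-odd-support m x h = trans
  (cong (λ c → fromℕ c ℚ.* p) (trans (count-Y-odd m (_≡ᵇ x)) (N-vanishes (m * 2) x λ k k≤ → h k (s≤s k≤))))
  (ℚ.*-zeroˡ p)
  where p = half ^ℚ (suc (m * 2) C 2)

-- The factor 2 ^ l in the count is cancelled by the l additional potential edges at the new vertex,
-- since `suc l C 2` exceeds `l C 2` by `l`.
PrY-even : ∀ m x → PrY (suc (suc (m * 2))) x ≡ PrY (suc (m * 2)) x
PrY-even m x = begin
  PrY (suc l) x
    ≡⟨ cong₂ (λ c e → fromℕ c ℚ.* (half ^ℚ e)) (count-Y-even m (_≡ᵇ x)) choose ⟩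
  fromℕ (2 ^ l * N (m * 2) x) ℚ.* (half ^ℚ (l + l C 2))
    ≡⟨ cong₂ ℚ._*_ (fromℕ-* (2 ^ l) (N (m * 2) x)) (half-+ l (l C 2)) ⟩
  (2^ℚ l ℚ.* c) ℚ.* ((half ^ℚ l) ℚ.* p)
    ≡⟨ solve 4 (λ q c t p → (q :* c) :* (t :* p) := (q :* t) :* (c :* p)) refl (2^ℚ l) c (half ^ℚ l) p ⟩
  (2^ℚ l ℚ.* (half ^ℚ l)) ℚ.* (c ℚ.* p)
    ≡⟨ cong (ℚ._* (c ℚ.* p)) (2^ℚ-half l) ⟩
  1ℚ ℚ.* (c ℚ.* p)
    ≡⟨ ℚ.*-identityˡ (c ℚ.* p) ⟩
  c ℚ.* p
    ≡⟨ cong (λ y → fromℕ y ℚ.* p) (count-Y-odd m (_≡ᵇ x)) ⟨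
  PrY l x ∎
  where
  open ≡-Reasoning
  open ℚ-Solver.+-*-Solver
  l = suc (m * 2)
  c = fromℕ (N (m * 2) x)
  p = half ^ℚ (l C 2)
  choose : suc l C 2 ≡ l + l C 2
  choose = trans (sym (nCk+nC[k+1]≡[n+1]C[k+1] l 1)) (cong (_+ l C 2) (nC1≡n l))

2*m+1≡ : ∀ m → 2 * m + 1 ≡ suc (m * 2)
2*m+1≡ m = trans (+-comm (2 * m) 1) (cong suc (*-comm 2 m))

2*m+2≡ : ∀ m → 2 * m + 2 ≡ suc (suc (m * 2))
2*m+2≡ m = trans (+-comm (2 * m) 2) (cong (2 +_) (*-comm 2 m))

theorem5p4 : ((m : ℕ) → let n = 2 * m + 1 in
    ((k : ℕ) → k < n → PrY n (2 ^ k) ≡ formula n k)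
    × ((x : ℕ) → ((k : ℕ) → k < n → x ≢ 2 ^ k) → PrY n x ≡ 0ℚ))
    × ((m : ℕ) → (x : ℕ) → PrY (2 * m + 2) x ≡ PrY (2 * m + 1) x)
theorem5p4 =
    (λ m → subst (λ n → ((k : ℕ) → k < n → PrY n (2 ^ k) ≡ formula n k)
                        × ((x : ℕ) → ((k : ℕ) → k < n → x ≢ 2 ^ k) → PrY n x ≡ 0ℚ))
                 (sym (2*m+1≡ m)) (PrY-odd m , PrY-odd-support m))
  , λ m x → subst₂ (λ a b → PrY a x ≡ PrY b x) (sym (2*m+2≡ m)) (sym (2*m+1≡ m)) (PrY-even m x)
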